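{- There is a deterministic Karp (polynomial-time many-one) reduction from the Permutation Code Equivalence problem (PCE) to the Linear Code Equivalence problem (LCE) that runs in time $\mathrm{poly}(n,\log q)$, where $n$ is the blocklength and $q$ is the field size of the input code pair. That is, there is a deterministic algorithm that, given a PCE instance $(\mathbf{G},\mathbf{H})$ of generator matrices in $\mathbb{F}_q^{k\times n}$, outputs in time $\mathrm{poly}(n,\log q)$ an LCE instance $(\mathbf{G}',\mathbf{H}')$ such that $(\mathbf{G},\mathbf{H})$ is a YES instance of PCE if and only if $(\mathbf{G}',\mathbf{H}')$ is a YES instance of LCE.
   Context: Let $q$ be a prime power and $\mathbb{F}_q$ the field of size $q$. A linear code $\mathcal{C}\subseteq\mathbb{F}_q^n$ of blocklength $n$ and dimension $k$ is a $k$-dimensional linear subspace of $\mathbb{F}_q^n$; a generator matrix of it is a matrix in $\mathbb{F}_q^{k\times n}$ whose row span is $\mathcal{C}$. $\mathcal{GL}_k(\mathbb{F}_q)$ is the group of invertible $k\times k$ matrices; $\mathcal{P}_n(\mathbb{F}_q)$ is the set of $n\times n$ permutation matrices (exactly one $1$ in each row and column, zeros elsewhere); $\mathcal{M}_n(\mathbb{F}_q)$ is the set of $n\times n$ monomial matrices (exactly one non-zero entry in each row and column, with values in $\mathbb{F}_q^*=\mathbb{F}_q\setminus\{0\}$). PCE is the decision problem: given generator matrices $\mathbf{G},\mathbf{H}\in\mathbb{F}_q^{k\times n}$, decide whether there exist $\mathbf{S}\in\mathcal{GL}_k(\mathbb{F}_q)$ and $\mathbf{P}\in\mathcal{P}_n(\mathbb{F}_q)$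 with $\mathbf{S}\mathbf{G}\mathbf{P}=\mathbf{H}$. LCE is the decision problem: given generator matrices $\mathbf{G},\mathbf{H}\in\mathbb{F}_q^{k\times n}$, decide whether there exist $\mathbf{S}\in\mathcal{GL}_k(\mathbb{F}_q)$ and $\mathbf{M}\in\mathcal{M}_n(\mathbb{F}_q)$ with $\mathbf{S}\mathbf{G}\mathbf{M}=\mathbf{H}$. In both problems the parameters $k,n,q$ are part of the instance, and field elements are encoded in the standard way with $O(\log q)$ bits. -}

module Defs where

open import Algebra.Bundles using (CommutativeRing)
import Algebra.Properties.Semiring.Exp as Exp
import Algebra.Properties.Semiring.Mult as Mult
import Algebra.Properties.Semiring.Sum as Sum
open import Data.Bool.Base using (Bool; true; false; if_then_else_)
open import Data.Fin.Base using (Fin; zero; toℕ)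
import Data.Fin.Properties as Fin
open import Data.List.Base using (List; []; _∷_; [_]; _++_; concat; concatMap; head; drop; replicate; tabulate)
open import Data.Maybe.Base using (Maybe)
open import Data.Nat.Base using (ℕ; zero; suc; _^_; _≡ᵇ_; _%_; ⌊_/2⌋)
open import Data.Nat.Logarithm using (⌊log₂_⌋)
open import Data.Nat.Primality using (Prime)
open import Data.Product using (Σ-syntax; ∃-syntax; ∃!; _×_; _,_)
open import Data.Sum.Base using (_⊎_)
open import Data.Vec.Base as Vec using (Vec)
open import Data.Vec.Functional using (Vector)
open import Function.Bundles using (_⇔_)
open import Level using (0ℓ)
open import Relation.Binary.PropositionalEquality.Core using (_≡_)
open import Relation.Nullary.Decidable.Core using (⌊_⌋)
open import Relation.Nullary.Negation.Core using (¬_)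

record Field : Set₁ where
  field
    commutativeRing : CommutativeRing 0ℓ 0ℓ
  open CommutativeRing commutativeRing public
  field
    1≉0     : ¬ 1# ≈ 0#
    inverse : ∀ x → ¬ x ≈ 0# → ∃[ y ] x * y ≈ 1#

module LinearAlgebra (F : Field) where
  open Field F
  open Sum semiring using (sum)

  Matrix : ℕ → ℕ → Set
  Matrix k n = Vector (Vector Carrier n) k

  infix 4 _≋_ _≋ᵐ_
  infixl 7 _⊡_

  _≋_ : ∀ {n} → Vector Carrier n → Vector Carrier n → Set
  v ≋ w = ∀ j → v j ≈ w j

  _≋ᵐ_ : ∀ {k n} → Matrix k n → Matrix k n → Set
  A ≋ᵐ B = ∀ i → A i ≋ B i

  _⊡_ : ∀ {k l n} → Matrix k l → Matrix l n → Matrix k n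
  (A ⊡ B) i j = sum (λ l → A i l * B l j)

  identity : ∀ {n} → Matrix n n
  identity i j = if ⌊ i Fin.≟ j ⌋ then 1# else 0#

  Invertible : ∀ {k} → Matrix k k → Set
  Invertible S = ∃[ T ] (S ⊡ T ≋ᵐ identity) × (T ⊡ S ≋ᵐ identity)

  IsPermutationMatrix : ∀ {n} → Matrix n n → Set
  IsPermutationMatrix P =
      (∀ i → ∃! _≡_ λ j → P i j ≈ 1#)
    × (∀ j → ∃! _≡_ λ i → P i j ≈ 1#)
    × (∀ i j → P i j ≈ 0# ⊎ P i j ≈ 1#)

  IsMonomialMatrix : ∀ {n} → Matrix n n → Set
  IsMonomialMatrix M =
      (∀ i → ∃! _≡_ λ j → ¬ M i j ≈ 0#)
    × (∀ j → ∃! _≡_ λ i → ¬ M i j ≈ 0#)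

  combination : ∀ {k n} → Vector Carrier k → Matrix k n → Vector Carrier n
  combination c A j = sum (λ i → c i * A i j)

  RowSpan : ∀ {k n} → Matrix k n → Vector Carrier n → Set
  RowSpan A v = ∃[ c ] combination c A ≋ v

  LinearlyIndependent : ∀ {k n} → Matrix k n → Set
  LinearlyIndependent A = ∀ c → combination c A ≋ (λ _ → 0#) → c ≋ (λ _ → 0#)

  record LinearCode (n : ℕ) : Set₁ where
    field
      Codeword : Vector Carrier n → Set
      respects : ∀ {v w} → v ≋ w → Codeword v → Codeword w
      0-closed : Codeword (λ _ → 0#)
      +-closed : ∀ {v w} → Codeword v → Codeword w → Codeword (λ j → v j + w j)
      *-closed : ∀ a {v} → Codeword v → Codeword (λ j → a * v j)

  HasDimension : ∀ {n} → LinearCode n → ℕ → Set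
  HasDimension {n} C k =
    Σ[ B ∈ Matrix k n ]
        (∀ i → Codeword (B i))
      × LinearlyIndependent B
      × (∀ v → Codeword v → RowSpan B v)
    where open LinearCode C

  -- The row span of the k × n matrix G is a linear code of dimension exactly k.
  IsGenerator : ∀ {k n} → Matrix k n → Set₁
  IsGenerator {k} {n} G =
    Σ[ C ∈ LinearCode n ]
        HasDimension C k
      × (∀ v → LinearCode.Codeword C v ⇔ RowSpan G v)

-- A field with q = p ^ m elements in the standard representation 𝔽ₚ[X]/(f),
-- where f = X ^ m + Σᵢ modulus i · X ^ i and α is the class of X: every element
-- is Σᵢ vᵢ · α ^ i for a unique vector v of residues modulo p.  That m is
-- positive and f irreducible over 𝔽ₚ follows from these axioms.
record FiniteField : Set₁ where
  field
    F : Field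
  open Field F public
  open Sum semiring using (sum)
  open Mult semiring using () renaming (_×_ to _·_)
  open Exp semiring using () renaming (_^_ to _^ᶠ_)
  field
    p m            : ℕ
    prime          : Prime p
    characteristic : p · 1# ≈ 0#
    α              : Carrier
    modulus        : Vec (Fin p) m

  evaluate : Vec (Fin p) m → Carrier
  evaluate v = sum (λ i → toℕ (Vec.lookup v i) · (α ^ᶠ toℕ i))

  field
    α-root               : α ^ᶠ m + evaluate modulus ≈ 0#
    coordinates          : Carrier → Vec (Fin p) m
    coordinates-cong     : ∀ {x y} → x ≈ y → coordinates x ≡ coordinates y
    evaluate-coordinates : ∀ x → evaluate (coordinates x) ≈ x
    coordinates-evaluate : ∀ v → coordinates (evaluate v) ≡ v

  q : ℕ
  q = p ^ m

-- The common instances of PCE and LCE.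
record Instance : Set₁ where
  field
    finiteField : FiniteField
  open FiniteField finiteField public using (F; q)
  open LinearAlgebra F public
  field
    k n         : ℕ
    G H         : Matrix k n
    G-generator : IsGenerator G
    H-generator : IsGenerator H

PCE : Instance → Set
PCE I = ∃[ S ] ∃[ P ] Invertible S × IsPermutationMatrix P × (S ⊡ G ⊡ P ≋ᵐ H)
  where open Instance I

LCE : Instance → Set
LCE I = ∃[ S ] ∃[ M ] Invertible S × IsMonomialMatrix M × (S ⊡ G ⊡ M ≋ᵐ H)
  where open Instance I

data Symbol : Set where
  bit : Bool → Symbol
  endCoefficient endElement endRow endMatrix : Symbol

-- The w low-order binary digits of a, least significant first.
binary : (w a : ℕ) → List Symbol
binary zero    a = []
binary (suc w) a = bit (a % 2 ≡ᵇ 1) ∷ binary w ⌊ a /2⌋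

unary : ℕ → List Symbol
unary a = replicate a (bit true) ++ [ endElement ]

-- The string p, f, k, n, G, H.  The integers p and 0, …, p ∸ 1 are written with
-- 1 + ⌊log₂ p⌋ bits, so a field element takes O(m log p) = O(log q) symbols.
-- The dimensions are in unary, so the whole string has length poly(n, log q) as
-- k ≤ n; n is given explicitly because the matrices do not determine it if k = 0.
encode : Instance → List Symbol
encode I = number p ++ element modulus ++ unary k ++ unary n ++ matrix G ++ matrix H
  where
  open Instance I
  open FiniteField finiteField using (Carrier; p; m; modulus; coordinates)

  number : ℕ → List Symbol
  number a = binary (suc ⌊log₂ p ⌋) a ++ [ endCoefficient ]

  element : Vec (Fin p) m → List Symbol
  element v = concatMap (λ a → number (toℕ a)) (Vec.toList v) ++ [ endElement ]

  row : Vector Carrier n → List Symbol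
  row v = concat (tabulate (λ j → element (coordinates (v j)))) ++ [ endRow ]

  matrix : Matrix k n → List Symbol
  matrix A = concat (tabulate (λ i → row (A i))) ++ [ endMatrix ]

-- Deterministic machines with a fixed number s of stacks of symbols.  Every
-- step inspects or changes only the top of one stack (`nothing` is the top of
-- an empty stack), and the commands still to be executed range over finitely
-- many lists, so these are multitape Turing machines with a finite control, each
-- stack being a tape, up to a constant factor in the running time.
data Command (s : ℕ) : Set where
  push   : Fin s → Symbol → Command s
  pop    : Fin s → Command s
  branch : Fin s → (Maybe Symbol → List (Command s)) → Command s
  while  : Fin s → (Maybe Symbol → Bool) → List (Command s) → Command s

Program : ℕ → Set
Program s = List (Command s)

Store : ℕ → Set
Store s = Vec (List Symbol) s

Configuration : ℕ → Set
Configuration s = Program s × Store s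

top : ∀ {s} → Store s → Fin s → Maybe Symbol
top σ i = head (Vec.lookup σ i)

step : ∀ {s} → Configuration s → Configuration s
step ([]              , σ) = [] , σ
step (push i a ∷ K    , σ) = K , σ Vec.[ i ]%= (a ∷_)
step (pop i ∷ K       , σ) = K , σ Vec.[ i ]%= drop 1
step (branch i P ∷ K  , σ) = P (top σ i) ++ K , σ
step (while i b P ∷ K , σ) = (if b (top σ i) then P ++ while i b P ∷ K else K) , σ

run : ∀ {s} → ℕ → Configuration s → Configuration s
run zero    c = c
run (suc t) c = run t (step c)

-- Started with x on the first stack and all others empty, M halts after at most t
-- steps with y on the first stack (a halted configuration is fixed by `step`).
Computes : ∀ {s} → Program (suc s) → ℕ → List Symbol → List Symbol → Set
Computes M t x y =
  ∃[ σ ] run t (M , x Vec.∷ Vec.replicate _ []) ≡ ([] , y Vec.∷ σ)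

{-# OPTIONS --safe #-}

-- A PCE instance G, H with n columns is sent to the (k + 1) × (6n + 1) matrices
--
--   G′ = ( 1  1ₙ 1ₙ 1ₙ  0  0  1ₙ )
--        ( 0  0  0  0   G  G  G  )
--
-- and H′.  A combination (t , c) of the rows of G′ has weight at most 3n if t = 0,
-- weight 4n + 1 if t ≠ 0 and c G = 0, and larger weight otherwise.  As a monomial
-- equivalence preserves weights and G has independent rows, its row transformation
-- is diag(t , A).  On the columns with nonzero first entry it therefore scales by
-- the constant 1 / t, so A / t sends the multiset of the columns of G, enlarged by
-- 3n + 1 zeros, to that of H enlarged in the same way; the zeros cancel.
--
-- Comparing q ^ k with q ^ n gives k ≤ n, so a machine that copies each row between
-- blocks of zeros prepared in advance takes O((n + log q)³) steps.
module Submission where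

open import Defs
import Algebra.Properties.CommutativeMonoid.Sum as CommutativeMonoidSum
import Algebra.Properties.CommutativeSemigroup as CommutativeSemigroup
import Algebra.Properties.Group as GroupProperties
import Algebra.Properties.Ring as RingProperties
import Algebra.Properties.Semiring.Exp as Exp
import Algebra.Properties.Semiring.Mult as Mult
import Algebra.Properties.Semiring.Sum as Sum
open import Data.Bool.Base using (Bool; true; false; if_then_else_)
open import Data.Fin.Base as Fin using (Fin; zero; suc; splitAt; punchIn; punchOut; funToFin; finToFun; join; toℕ; _↑ˡ_; _↑ʳ_)
open import Data.Fin.Patterns
open import Data.Fin.Permutation as Perm using (Permutation′; _⟨$⟩ʳ_; _⟨$⟩ˡ_; _∘ₚ_)
import Data.Fin.Properties as Fin
open import Data.List.Base as List using (List; []; _∷_; [_]; _++_; _ʳ++_; foldl; length)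
import Data.List.Properties as List
open import Data.List.Relation.Unary.All as All using (All; []; _∷_)
import Data.List.Relation.Unary.All.Properties as All
open import Data.Maybe.Base using (Maybe; just; nothing; is-just)
open import Data.Nat.Base as ℕ using (ℕ; zero; suc; z≤n; s≤s; NonZero)
open import Data.Nat.Induction using (<-rec)
open import Data.Nat.Logarithm using (⌊log₂_⌋; ⌈log₂_⌉; ⌊log₂⌋-mono-≤; ⌈log₂⌉-mono-≤; ⌊log₂⌊n/2⌋⌋≡⌊log₂n⌋∸1; ⌈log₂2^n⌉≡n)
open import Data.Nat.Primality using (prime⇒nonTrivial)
import Data.Nat.Properties as ℕ
open import Data.Nat.Solver using (module +-*-Solver)
open import Data.Product.Base using (Σ-syntax; ∃-syntax; _×_; _,_; proj₁; proj₂)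
open import Data.Sum.Base as Sum⊎ using (_⊎_; [_,_]′; inj₁; inj₂)
open import Data.Vec.Base as Vec using (Vec; []; _∷_)
import Data.Vec.Functional as Vector
open import Data.Vec.Functional using (Vector)
import Data.Vec.Functional.Properties as VectorProperties
import Data.Vec.Properties as Vec
open import Function.Base using (_∘_; const; id)
open import Function.Bundles using (_⇔_; mk⇔; module Equivalence)
open import Function.Definitions using (Injective)
open import Level using (0ℓ)
open import Relation.Binary.Bundles using (Setoid)
open import Relation.Binary.Definitions using (Decidable)
open import Relation.Binary.PropositionalEquality as ≡ using (_≡_; _≢_; _≗_)
open import Relation.Nullary.Decidable using (yes; no; ⌊_⌋; decidable-stable; map′)
open import Relation.Nullary.Negation using (¬_; contradiction)

-- The obstacle is that a monomial matrix may scale each column by its own factor. The row of ones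
-- controls this only where it is nonzero, so one copy of `G` stands under ones, in the `link`
-- columns; the other two copies serve the weights alone. An entry `x i + t` of a `link` column
-- vanishes when `x i` is the negative of `t`, and a single `plain` copy would merely make up for
-- this loss; two copies turn it into a gain. Three copies of `G` can reach weight 3n by themselves,
-- hence 3n + 1 marks to tell `t = 0` from `t ≠ 0`. A zero column of `G` makes its `link` column
-- equal to a `mark` column, so a monomial equivalence can exchange the two types. This is why the
-- columns are compared as multisets with added zeros, and not block by block. In each row of the
-- reduced matrix one summand of `x i + t` is zero, so every entry is 0, 1 or an entry of `G`, and
-- the machine needs no field arithmetic.

-- Column types and their arrangement

-- The columns of a reduced generator matrix, up to repetition: the row (t , x) has
-- the entries t, xᵢ and xᵢ + t in the columns `mark`, `plain i` and `link i`.
data Column (n : ℕ) : Set where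
  mark       : Column n
  plain link : Fin n → Column n

reducedLength : ℕ → ℕ
reducedLength n = suc (n ℕ.+ (n ℕ.+ (n ℕ.+ (n ℕ.+ (n ℕ.+ n)))))

marks : ∀ {n} → Vector (Column n) n
marks _ = mark

-- Storing types instead of entries lets one arrangement serve matrices, weights, permutations and
-- strings. The `link` block comes last because cancellation removes blocks from the front.
columns : ∀ n → Vector (Column n) (reducedLength n)
columns n = mark Vector.∷ (marks Vector.++ (marks Vector.++ (marks Vector.++ (plain Vector.++ (plain Vector.++ link)))))

++-suc : ∀ {A : Set} {m n} (xs : Vector A (suc m)) (ys : Vector A n) i →
         (xs Vector.++ ys) (suc i) ≡ (xs ∘ suc Vector.++ ys) i
++-suc {m = m} xs ys i with splitAt m i
... | inj₁ _ = ≡.refl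
... | inj₂ _ = ≡.refl

-- Sums of natural numbers

open CommutativeMonoidSum ℕ.+-0-commutativeMonoid using (∑-permute) renaming (sum to ∑; sum-cong-≗ to ∑-cong; ∑-distrib-+ to ∑-distrib)

∑-mono : ∀ {n} {f g : Vector ℕ n} → (∀ i → f i ℕ.≤ g i) → ∑ f ℕ.≤ ∑ g
∑-mono {zero}  f≤g = z≤n
∑-mono {suc n} f≤g = ℕ.+-mono-≤ (f≤g zero) (∑-mono (f≤g ∘ suc))

∑-const : ∀ n c → ∑ {n} (const c) ≡ n ℕ.* c
∑-const zero    c = ≡.refl
∑-const (suc n) c = ≡.cong (c ℕ.+_) (∑-const n c)

∑-++ : ∀ {A : Set} (f : A → ℕ) {m n} (xs : Vector A m) (ys : Vector A n) →
       ∑ (f ∘ (xs Vector.++ ys)) ≡ ∑ (f ∘ xs) ℕ.+ ∑ (f ∘ ys)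
∑-++ f {zero}  xs ys = ≡.refl
∑-++ f {suc m} xs ys = ≡.trans
  (≡.cong (f (xs zero) ℕ.+_) (≡.trans (∑-cong λ i → ≡.cong f (++-suc xs ys i)) (∑-++ f (xs ∘ suc) ys)))
  (≡.sym (ℕ.+-assoc (f (xs zero)) _ _))

∑≡0 : ∀ {n} (f : Vector ℕ n) → ∑ f ≡ 0 → ∀ i → f i ≡ 0
∑≡0 f eq zero    = ℕ.m+n≡0⇒m≡0 (f zero) eq
∑≡0 f eq (suc i) = ∑≡0 (f ∘ suc) (ℕ.m+n≡0⇒n≡0 (f zero) eq) i

-- Lifting permutations to the reduced columns

Realizes : ∀ {A : Set} {n} → (A → A) → Vector A n → Set
Realizes {n = n} φ xs = Σ[ π ∈ Permutation′ n ] (∀ i → xs (π ⟨$⟩ʳ i) ≡ φ (xs i))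

++-realizes : ∀ {A : Set} (φ : A → A) {m n} (xs : Vector A m) (ys : Vector A n) →
              Realizes φ xs → Realizes φ ys → Realizes φ (xs Vector.++ ys)
++-realizes φ {m} {n} xs ys (π , π≡) (ρ , ρ≡) = Perm.permutation to from to-from from-to , realizes
  where
  to from : Fin (m ℕ.+ n) → Fin (m ℕ.+ n)
  to   i = join m n (Sum⊎.map (π ⟨$⟩ʳ_) (ρ ⟨$⟩ʳ_) (splitAt m i))
  from i = join m n (Sum⊎.map (π ⟨$⟩ˡ_) (ρ ⟨$⟩ˡ_) (splitAt m i))

  to-from : ∀ i → to (from i) ≡ i
  to-from i = ≡.trans (≡.cong (join m n ∘ Sum⊎.map _ _) (Fin.splitAt-join m n (Sum⊎.map _ _ (splitAt m i))))
    (≡.trans (≡.cong (join m n) (cancel (splitAt m i))) (Fin.join-splitAt m n i))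
    where
    cancel : ∀ x → Sum⊎.map (π ⟨$⟩ʳ_) (ρ ⟨$⟩ʳ_) (Sum⊎.map (π ⟨$⟩ˡ_) (ρ ⟨$⟩ˡ_) x) ≡ x
    cancel (inj₁ x) = ≡.cong inj₁ (Perm.inverseʳ π)
    cancel (inj₂ x) = ≡.cong inj₂ (Perm.inverseʳ ρ)

  from-to : ∀ i → from (to i) ≡ i
  from-to i = ≡.trans (≡.cong (join m n ∘ Sum⊎.map _ _) (Fin.splitAt-join m n (Sum⊎.map _ _ (splitAt m i))))
    (≡.trans (≡.cong (join m n) (cancel (splitAt m i))) (Fin.join-splitAt m n i))
    where
    cancel : ∀ x → Sum⊎.map (π ⟨$⟩ˡ_) (ρ ⟨$⟩ˡ_) (Sum⊎.map (π ⟨$⟩ʳ_) (ρ ⟨$⟩ʳ_) x) ≡ x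
    cancel (inj₁ x) = ≡.cong inj₁ (Perm.inverseˡ π)
    cancel (inj₂ x) = ≡.cong inj₂ (Perm.inverseˡ ρ)

  realizes : ∀ i → (xs Vector.++ ys) (to i) ≡ φ ((xs Vector.++ ys) i)
  realizes i = ≡.trans (≡.cong [ xs , ys ]′ (Fin.splitAt-join m n (Sum⊎.map _ _ (splitAt m i)))) (case (splitAt m i))
    where
    case : ∀ x → [ xs , ys ]′ (Sum⊎.map (π ⟨$⟩ʳ_) (ρ ⟨$⟩ʳ_) x) ≡ φ ([ xs , ys ]′ x)
    case (inj₁ x) = π≡ x
    case (inj₂ x) = ρ≡ x

mapColumn : ∀ {n} → (Fin n → Fin n) → Column n → Column n
mapColumn f mark      = mark
mapColumn f (plain i) = plain (f i)
mapColumn f (link i)  = link (f i)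

-- The marks stay in place, while `π` acts separately inside both `plain` blocks and the `link`
-- block.
columns-realizes : ∀ {n} (π : Permutation′ n) → Realizes (mapColumn (π ⟨$⟩ʳ_)) (columns n)
columns-realizes {n} π = Perm.lift₀ (proj₁ rest) , λ { zero → ≡.refl ; (suc i) → proj₂ rest i }
  where
  f = mapColumn (π ⟨$⟩ʳ_)
  marks-realizes : Realizes {n = n} f marks
  marks-realizes = Perm.id , λ _ → ≡.refl
  rest = ++-realizes f marks _ marks-realizes (++-realizes f marks _ marks-realizes (++-realizes f marks _ marks-realizes
    (++-realizes f plain _ (π , λ _ → ≡.refl) (++-realizes f plain link (π , λ _ → ≡.refl) (π , λ _ → ≡.refl)))))

-- Cancellation of equal columns

module Cancellation (X : Setoid 0ℓ 0ℓ) where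

  open Setoid X

  -- The preimage of 0 is sent to the former image of 0 instead.
  cancel-head : ∀ {n} {f g : Vector Carrier (suc n)} (π : Permutation′ (suc n)) →
                (∀ i → f i ≈ g (π ⟨$⟩ʳ i)) → f zero ≈ g zero →
                Σ[ ρ ∈ Permutation′ n ] (∀ i → f (suc i) ≈ g (suc (ρ ⟨$⟩ʳ i)))
  cancel-head {f = f} {g} π f≈g f₀≈g₀ = Perm.remove zero σ , λ i →
    trans (f≈gσ (suc i)) (reflexive (≡.cong g (≡.trans (Perm.punchIn-permute σ zero i)
      (≡.cong (λ j → punchIn j (Perm.remove zero σ ⟨$⟩ʳ i)) σ₀≡0))))
    where
    π₀ = π ⟨$⟩ʳ zero
    σ = π ∘ₚ Perm.transpose π₀ zero

    σ₀≡0 : σ ⟨$⟩ʳ zero ≡ zero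
    σ₀≡0 with π₀ Fin.≟ π₀
    ... | yes _    = ≡.refl
    ... | no π₀≢π₀ = contradiction ≡.refl π₀≢π₀

    f≈gσ : ∀ i → f i ≈ g (σ ⟨$⟩ʳ i)
    f≈gσ i with π ⟨$⟩ʳ i Fin.≟ π₀
    ... | yes πi≡π₀ = trans (f≈g i) (trans (reflexive (≡.cong g πi≡π₀)) (trans (sym (f≈g zero)) f₀≈g₀))
    ... | no _ with π ⟨$⟩ʳ i Fin.≟ zero
    ...   | yes πi≡0 = trans (f≈g i) (trans (reflexive (≡.cong g πi≡0)) (trans (sym f₀≈g₀) (f≈g zero)))
    ...   | no _     = f≈g i

  cancel-++ : ∀ {A : Set} (φ ψ : A → Carrier) {m n} (xs : Vector A m) (ys : Vector A n) →
              (∀ i → φ (xs i) ≈ ψ (xs i)) → (π : Permutation′ (m ℕ.+ n)) →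
              (∀ i → φ ((xs Vector.++ ys) i) ≈ ψ ((xs Vector.++ ys) (π ⟨$⟩ʳ i))) →
              Σ[ ρ ∈ Permutation′ n ] (∀ i → φ (ys i) ≈ ψ (ys (ρ ⟨$⟩ʳ i)))
  cancel-++ φ ψ {zero}  xs ys φ≈ψ π eq = π , eq
  cancel-++ φ ψ {suc m} xs ys φ≈ψ π eq with cancel-head {f = φ ∘ (xs Vector.++ ys)} {ψ ∘ (xs Vector.++ ys)} π eq (φ≈ψ zero)
  ... | ρ , eq′ = cancel-++ φ ψ (xs ∘ suc) ys (φ≈ψ ∘ suc) ρ λ i →
    trans (reflexive (≡.cong φ (≡.sym (++-suc xs ys i)))) (trans (eq′ i) (reflexive (≡.cong ψ (++-suc xs ys (ρ ⟨$⟩ʳ i)))))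

-- The pigeonhole principle

-- If `y` were missed, punching it out of the codomain would inject `Fin (suc n)` into `Fin n`.
injective⇒surjective : ∀ {n} {f : Fin n → Fin n} → Injective _≡_ _≡_ f → ∀ y → ∃[ x ] f x ≡ y
injective⇒surjective {suc n} {f} inj y with Fin.any? (λ x → f x Fin.≟ y)
... | yes image = image
... | no ¬image = contradiction
  (Fin.injective⇒≤ {f = λ x → punchOut (avoid x)} λ {x} {x′} eq → inj (Fin.punchOut-injective (avoid x) (avoid x′) eq))
  (ℕ.<⇒≱ ℕ.≤-refl)
  where
  avoid : ∀ x → y ≢ f x
  avoid x y≡fx = ¬image (x , ≡.sym y≡fx)

funToFin-cong : ∀ {m n} {f g : Fin m → Fin n} → f ≗ g → funToFin f ≡ funToFin g
funToFin-cong {zero}  f≗g = ≡.refl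
funToFin-cong {suc m} f≗g = ≡.cong₂ Fin.combine (f≗g zero) (funToFin-cong (f≗g ∘ suc))

-- The reduced matrix

module ReducedMatrix (F : Field) where

  open Field F using (Carrier; _+_; 0#; 1#)

  entry : ∀ {n} → Carrier → Vector Carrier n → Column n → Carrier
  entry t x mark      = t
  entry t x (plain i) = x i
  entry t x (link i)  = x i + t

  reduced : ∀ {k n} → Vector (Vector Carrier n) k → Vector (Vector Carrier (reducedLength n)) (suc k)
  reduced {n = n} A =
    (entry 1# (const 0#) ∘ columns n) Vector.∷ (λ i → entry 0# (A i) ∘ columns n)

-- Row combinations over a field with decidable equality

module FieldAlgebra (F : Field) (_≟_ : Decidable (Field._≈_ F)) where

  open Field F hiding (zero)
  open LinearAlgebra F
  open Sum semiring using (sum; sum-cong-≋; sum-remove; sum-replicate-zero; ∑-distrib-+; ∑-comm; *-distribˡ-sum; *-distribʳ-sum)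
  open CommutativeSemigroup *-commutativeSemigroup using () renaming (interchange to *-interchange)
  open RingProperties ring using (-1*x≈-x)
  open GroupProperties +-group using () renaming (x∙y⁻¹≈ε⇒x≈y to x-y≈0⇒x≈y; x≈y⇒x∙y⁻¹≈ε to x≈y⇒x-y≈0)
  open import Relation.Binary.Reasoning.Setoid setoid

  sum-zero : ∀ {n} {f : Vector Carrier n} → (∀ i → f i ≈ 0#) → sum f ≈ 0#
  sum-zero {n} f≈0 = trans (sum-cong-≋ f≈0) (sum-replicate-zero n)

  sum-single : ∀ {n} {f : Vector Carrier n} i → (∀ j → j ≢ i → f j ≈ 0#) → sum f ≈ f i
  sum-single {suc n} {f} i f≈0 = begin
    sum f                             ≈⟨ sum-remove f ⟩
    f i + sum (Vector.removeAt f i)   ≈⟨ +-congˡ (sum-zero λ j → f≈0 (punchIn i j) (Fin.punchInᵢ≢i i j)) ⟩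
    f i + 0#                          ≈⟨ +-identityʳ (f i) ⟩
    f i                               ∎

  *-nonzero : ∀ {x y} → ¬ x ≈ 0# → ¬ y ≈ 0# → ¬ x * y ≈ 0#
  *-nonzero {x} {y} x≉0 y≉0 xy≈0 with inverse x x≉0
  ... | x⁻¹ , xx⁻¹≈1 = y≉0 (begin
    y                 ≈⟨ *-identityˡ y ⟨
    1# * y            ≈⟨ *-congʳ (trans (*-comm x⁻¹ x) xx⁻¹≈1) ⟨
    x⁻¹ * x * y       ≈⟨ *-assoc x⁻¹ x y ⟩
    x⁻¹ * (x * y)     ≈⟨ *-congˡ xy≈0 ⟩
    x⁻¹ * 0#          ≈⟨ zeroʳ x⁻¹ ⟩
    0#                ∎)

  identity-diagonal : ∀ {n} (i : Fin n) → identity i i ≡ 1#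
  identity-diagonal i with i Fin.≟ i
  ... | yes _  = ≡.refl
  ... | no i≢i = contradiction ≡.refl i≢i

  identity-off-diagonal : ∀ {n} {i j : Fin n} → i ≢ j → identity i j ≡ 0#
  identity-off-diagonal {i = i} {j} i≢j with i Fin.≟ j
  ... | yes i≡j = contradiction i≡j i≢j
  ... | no _    = ≡.refl

  identity-suc : ∀ {n} (i j : Fin n) → identity (suc i) (suc j) ≡ identity i j
  identity-suc i j with i Fin.≟ j
  ... | yes _ = ≡.refl
  ... | no _  = ≡.refl

  combination-cong : ∀ {k n} {c d} {A B : Matrix k n} → c ≋ d → A ≋ᵐ B → combination c A ≋ combination d B
  combination-cong c≋d A≋B j = sum-cong-≋ λ i → *-cong (c≋d i) (A≋B i j)

  combination-zero : ∀ {k n} {c} {A : Matrix k n} → c ≋ const 0# → combination c A ≋ const 0#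
  combination-zero c≋0 j = sum-zero λ i → trans (*-congʳ (c≋0 i)) (zeroˡ _)

  combination-+ : ∀ {k n} c d (A : Matrix k n) →
                  combination (λ i → c i + d i) A ≋ (λ j → combination c A j + combination d A j)
  combination-+ c d A j = trans (sum-cong-≋ λ i → distribʳ (A i j) (c i) (d i)) (∑-distrib-+ (λ i → c i * A i j) (λ i → d i * A i j))

  combination-* : ∀ {k n} a c (A : Matrix k n) → combination (λ i → a * c i) A ≋ (λ j → a * combination c A j)
  combination-* a c A j = trans (sum-cong-≋ λ i → *-assoc a (c i) (A i j)) (sym (*-distribˡ-sum a (λ i → c i * A i j)))

  combination-identity : ∀ {k n} (A : Matrix k n) i → combination (identity i) A ≋ A i
  combination-identity A i j = begin
    combination (identity i) A j ≈⟨ sum-single i (λ l l≢i → trans (*-congʳ (reflexive (identity-off-diagonal (l≢i ∘ ≡.sym)))) (zeroˡ _)) ⟩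
    identity i i * A i j         ≈⟨ *-congʳ (reflexive (identity-diagonal i)) ⟩
    1# * A i j                   ≈⟨ *-identityˡ _ ⟩
    A i j                        ∎

  combination-⊡ : ∀ {h k n} c (T : Matrix h k) (A : Matrix k n) → combination c (T ⊡ A) ≋ combination (combination c T) A
  combination-⊡ c T A j = begin
    sum (λ i → c i * sum (λ l → T i l * A l j))      ≈⟨ sum-cong-≋ (λ i → *-distribˡ-sum (c i) (λ l → T i l * A l j)) ⟩
    sum (λ i → sum (λ l → c i * (T i l * A l j)))    ≈⟨ ∑-comm (λ i l → c i * (T i l * A l j)) ⟩
    sum (λ l → sum (λ i → c i * (T i l * A l j)))    ≈⟨ sum-cong-≋ (λ l → sum-cong-≋ λ i → sym (*-assoc (c i) (T i l) (A l j))) ⟩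
    sum (λ l → sum (λ i → c i * T i l * A l j))      ≈⟨ sum-cong-≋ (λ l → sym (*-distribʳ-sum (A l j) (λ i → c i * T i l))) ⟩
    sum (λ l → sum (λ i → c i * T i l) * A l j)      ∎

  independent⇒injective : ∀ {k n} {A : Matrix k n} → LinearlyIndependent A → ∀ {c d} → combination c A ≋ combination d A → c ≋ d
  independent⇒injective {A = A} independent {c} {d} cA≋dA i = x-y≈0⇒x≈y _ _ (independent (λ i → c i - d i) (λ j → begin
    combination (λ i → c i - d i) A j                          ≈⟨ combination-+ c (λ i → - d i) A j ⟩
    combination c A j + combination (λ i → - d i) A j          ≈⟨ +-congˡ (combination-neg j) ⟩
    combination c A j - combination d A j                      ≈⟨ x≈y⇒x-y≈0 (cA≋dA j) ⟩
    0#                                                         ∎) i)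
    where
    combination-neg : combination (λ i → - d i) A ≋ (λ j → - combination d A j)
    combination-neg j = begin
      combination (λ i → - d i) A j         ≈⟨ combination-cong {A = A} (λ i → sym (-1*x≈-x (d i))) (λ _ _ → refl) j ⟩
      combination (λ i → - 1# * d i) A j    ≈⟨ combination-* (- 1#) d A j ⟩
      - 1# * combination d A j              ≈⟨ -1*x≈-x _ ⟩
      - combination d A j                   ∎

  -- The rows of `A` are themselves a basis of their span.
  independent⇒generator : ∀ {k n} {A : Matrix k n} → LinearlyIndependent A → IsGenerator A
  independent⇒generator {A = A} independent = code , (A , (λ i → identity i , combination-identity A i) , independent , λ _ → id) , λ _ → mk⇔ id id
    where
    code : LinearCode _
    code = record
      { Codeword = RowSpan A
      ; respects = λ v≋w (c , cA≋v) → c , λ j → trans (cA≋v j) (v≋w j)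
      ; 0-closed = const 0# , combination-zero {A = A} (λ _ → refl)
      ; +-closed = λ (c , cA≋v) (d , dA≋w) → (λ i → c i + d i) , λ j → trans (combination-+ c d A j) (+-cong (cA≋v j) (dA≋w j))
      ; *-closed = λ a (c , cA≋v) → (λ i → a * c i) , λ j → trans (combination-* a c A j) (*-congˡ (cA≋v j))
      }

  -- Permutation and monomial matrices

  permutationMatrix : ∀ {n} → Permutation′ n → Matrix n n
  permutationMatrix π i = identity (π ⟨$⟩ʳ i)

  permutationMatrix-isPermutation : ∀ {n} (π : Permutation′ n) → IsPermutationMatrix (permutationMatrix π)
  permutationMatrix-isPermutation π =
      (λ i → π ⟨$⟩ʳ i , reflexive (identity-diagonal (π ⟨$⟩ʳ i)) , support)
    , (λ j → π ⟨$⟩ˡ j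
           , reflexive (≡.trans (≡.cong (λ l → identity l j) (Perm.inverseʳ π)) (identity-diagonal j))
           , λ {i} eq → ≡.trans (≡.cong (π ⟨$⟩ˡ_) (≡.sym (support eq))) (Perm.inverseˡ π))
    , zero-one
    where
    support : ∀ {i j} → permutationMatrix π i j ≈ 1# → π ⟨$⟩ʳ i ≡ j
    support {i} {j} eq with π ⟨$⟩ʳ i Fin.≟ j
    ... | yes πi≡j = πi≡j
    ... | no _     = contradiction (sym eq) 1≉0

    zero-one : ∀ i j → permutationMatrix π i j ≈ 0# ⊎ permutationMatrix π i j ≈ 1#
    zero-one i j with π ⟨$⟩ʳ i Fin.≟ j
    ... | yes _ = inj₂ refl
    ... | no _  = inj₁ refl

  ⊡-permutationMatrix : ∀ {k n} (A : Matrix k n) (π : Permutation′ n) i j → (A ⊡ permutationMatrix π) i j ≈ A i (π ⟨$⟩ˡ j)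
  ⊡-permutationMatrix A π i j = begin
    (A ⊡ permutationMatrix π) i j
      ≈⟨ sum-single (π ⟨$⟩ˡ j) (λ l l≢ → trans (*-congˡ (reflexive (identity-off-diagonal
           λ πl≡j → l≢ (≡.trans (≡.sym (Perm.inverseˡ π)) (≡.cong (π ⟨$⟩ˡ_) πl≡j))))) (zeroʳ _)) ⟩
    A i (π ⟨$⟩ˡ j) * identity (π ⟨$⟩ʳ (π ⟨$⟩ˡ j)) j
      ≈⟨ *-congˡ (reflexive (≡.trans (≡.cong (λ l → identity l j) (Perm.inverseʳ π)) (identity-diagonal j))) ⟩
    A i (π ⟨$⟩ˡ j) * 1#
      ≈⟨ *-identityʳ _ ⟩
    A i (π ⟨$⟩ˡ j) ∎

  private
    nonzero⇒one : ∀ {x} → x ≈ 0# ⊎ x ≈ 1# → ¬ x ≈ 0# → x ≈ 1#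
    nonzero⇒one (inj₁ x≈0) x≉0 = contradiction x≈0 x≉0
    nonzero⇒one (inj₂ x≈1) x≉0 = x≈1

    one⇒nonzero : ∀ {x} → x ≈ 1# → ¬ x ≈ 0#
    one⇒nonzero x≈1 x≈0 = 1≉0 (trans (sym x≈1) x≈0)

  permutation⇒monomial : ∀ {n} {P : Matrix n n} → IsPermutationMatrix P → IsMonomialMatrix P
  permutation⇒monomial (row , column , zero-one) =
      (λ i → let j , eq , unique = row i in j , one⇒nonzero eq , λ {l} → unique ∘ nonzero⇒one (zero-one i l))
    , (λ j → let i , eq , unique = column j in i , one⇒nonzero eq , λ {l} → unique ∘ nonzero⇒one (zero-one l j))

  module Monomial {n} {M : Matrix n n} (monomial : IsMonomialMatrix M) where

    private
      ρ κ : Fin n → Fin n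
      ρ i = proj₁ (proj₁ monomial i)
      κ j = proj₁ (proj₂ monomial j)

      κ-unique : ∀ {i j} → ¬ M i j ≈ 0# → κ j ≡ i
      κ-unique {i} {j} = proj₂ (proj₂ (proj₂ monomial j))

    -- By the two uniqueness clauses, row supports and column supports are inverse to each other;
    -- thus `M` is the diagonal matrix of `scale` followed by this permutation.
    permutation : Permutation′ n
    permutation = Perm.permutation ρ κ
      (λ j → proj₂ (proj₂ (proj₁ monomial (κ j))) (proj₁ (proj₂ (proj₂ monomial j))))
      (λ i → κ-unique (proj₁ (proj₂ (proj₁ monomial i))))

    scale : Vector Carrier n
    scale i = M i (ρ i)

    scale≉0 : ∀ i → ¬ scale i ≈ 0#
    scale≉0 i = proj₁ (proj₂ (proj₁ monomial i))

    ⊡-monomial : ∀ {k} (A : Matrix k n) i j → (A ⊡ M) i (permutation ⟨$⟩ʳ j) ≈ A i j * scale j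
    -- Uniqueness speaks of nonzero entries only, so the vanishing of the others is obtained by
    -- contradiction from decidable equality.
    ⊡-monomial A i j = sum-single j λ l l≢j → trans (*-congˡ (decidable-stable (M l (ρ j) ≟ 0#)
      λ M≉0 → l≢j (≡.trans (≡.sym (κ-unique M≉0)) (κ-unique (scale≉0 j))))) (zeroʳ _)

  -- Hamming weight

  weigh : Carrier → ℕ
  weigh x = if ⌊ x ≟ 0# ⌋ then 0 else 1

  weigh-zero : ∀ {x} → x ≈ 0# → weigh x ≡ 0
  weigh-zero {x} x≈0 with x ≟ 0#
  ... | yes _   = ≡.refl
  ... | no x≉0  = contradiction x≈0 x≉0

  weigh-nonzero : ∀ {x} → ¬ x ≈ 0# → weigh x ≡ 1
  weigh-nonzero {x} x≉0 with x ≟ 0#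
  ... | yes x≈0 = contradiction x≈0 x≉0
  ... | no _    = ≡.refl

  weigh-cong : ∀ {x y} → x ≈ y → weigh x ≡ weigh y
  weigh-cong {x} {y} x≈y with x ≟ 0# | y ≟ 0#
  ... | yes _   | yes _   = ≡.refl
  ... | yes x≈0 | no y≉0  = contradiction (trans (sym x≈y) x≈0) y≉0
  ... | no x≉0  | yes y≈0 = contradiction (trans x≈y y≈0) x≉0
  ... | no _    | no _    = ≡.refl

  weigh-scale : ∀ x {y} → ¬ y ≈ 0# → weigh (x * y) ≡ weigh x
  weigh-scale x {y} y≉0 with x ≟ 0#
  ... | yes x≈0 = weigh-zero (trans (*-congʳ x≈0) (zeroˡ y))
  ... | no x≉0  = weigh-nonzero (*-nonzero x≉0 y≉0)

  weigh≤1 : ∀ x → weigh x ℕ.≤ 1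
  weigh≤1 x with x ≟ 0#
  ... | yes _ = z≤n
  ... | no _  = s≤s z≤n

  weight : ∀ {n} → Vector Carrier n → ℕ
  weight v = ∑ (weigh ∘ v)

  weight≤n : ∀ {n} (v : Vector Carrier n) → weight v ℕ.≤ n
  weight≤n {n} v = ℕ.≤-trans (∑-mono (weigh≤1 ∘ v)) (ℕ.≤-reflexive (≡.trans (∑-const n 1) (ℕ.*-identityʳ n)))

  weight-monomial : ∀ {n} {v w l : Vector Carrier n} (π : Permutation′ n) → (∀ j → ¬ l j ≈ 0#) →
                    (∀ j → v j * l j ≈ w (π ⟨$⟩ʳ j)) → weight v ≡ weight w
  weight-monomial {v = v} {w} π l≉0 vl≈wπ = ≡.trans
    (∑-cong λ j → ≡.trans (≡.sym (weigh-scale (v j) (l≉0 j))) (weigh-cong (vl≈wπ j)))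
    (≡.sym (∑-permute (weigh ∘ w) π))

  -- Weights of combinations of reduced rows

  open ReducedMatrix F

  entry-cong : ∀ {n t u} {x y : Vector Carrier n} → t ≈ u → x ≋ y → ∀ c → entry t x c ≈ entry u y c
  entry-cong t≈u x≋y mark      = t≈u
  entry-cong t≈u x≋y (plain i) = x≋y i
  entry-cong t≈u x≋y (link i)  = +-cong (x≋y i) t≈u

  -- Each entry is linear in `(t , x)`, so a combination of rows has the same shape as a row; the
  -- weight formulas for `entry t x` therefore cover all codewords.
  combination-reduced : ∀ {k n} d (A : Matrix k n) j →
    combination d (reduced A) j ≈ entry (d zero) (combination (d ∘ suc) A) (columns n j)
  combination-reduced {n = n} d A j = case (columns n j)
    where
    case : ∀ c → d zero * entry 1# (const 0#) c + sum (λ i → d (suc i) * entry 0# (A i) c) ≈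
                 entry (d zero) (combination (d ∘ suc) A) c
    case mark      = trans (+-cong (*-identityʳ _) (sum-zero λ i → zeroʳ (d (suc i)))) (+-identityʳ _)
    case (plain i) = trans (+-congʳ (zeroʳ _)) (+-identityˡ _)
    case (link i)  = begin
      d zero * (0# + 1#) + sum (λ a → d (suc a) * (A a i + 0#))   ≈⟨ +-comm _ _ ⟩
      sum (λ a → d (suc a) * (A a i + 0#)) + d zero * (0# + 1#)   ≈⟨ +-cong (sum-cong-≋ λ a → *-congˡ (+-identityʳ (A a i))) (trans (*-congˡ (+-identityˡ 1#)) (*-identityʳ (d zero))) ⟩
      sum (λ a → d (suc a) * A a i) + d zero                      ∎

  -- The first `plain` block lies behind the leading `mark` and three blocks of marks. It is used to
  -- find `A` inside `reduced A`.
  plain-column : ∀ {n} (i : Fin n) → ∃[ j ] columns n j ≡ plain i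
  plain-column {n} i = suc (n ↑ʳ (n ↑ʳ (n ↑ʳ (i ↑ˡ (n ℕ.+ n))))) ,
    ≡.trans (VectorProperties.lookup-++ʳ (marks {n}) _ (n ↑ʳ (n ↑ʳ (i ↑ˡ (n ℕ.+ n)))))
    (≡.trans (VectorProperties.lookup-++ʳ (marks {n}) _ (n ↑ʳ (i ↑ˡ (n ℕ.+ n))))
    (≡.trans (VectorProperties.lookup-++ʳ (marks {n}) _ (i ↑ˡ (n ℕ.+ n)))
    (VectorProperties.lookup-++ˡ plain (plain Vector.++ link) i)))

  reduced-independent : ∀ {k n} {A : Matrix k n} → LinearlyIndependent A → LinearlyIndependent (reduced A)
  -- The leading column is `mark`, where the combination has the entry `d zero`.
  reduced-independent {n = n} {A} independent d dA′≋0 zero    = trans (sym (combination-reduced d A zero)) (dA′≋0 zero)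
  reduced-independent {n = n} {A} independent d dA′≋0 (suc a) = independent (d ∘ suc) (λ i →
    let j , eq = plain-column i in begin
    combination (d ∘ suc) A i                                           ≡⟨ ≡.cong (entry (d zero) (combination (d ∘ suc) A)) eq ⟨
    entry (d zero) (combination (d ∘ suc) A) (columns n j)              ≈⟨ combination-reduced d A j ⟨
    combination d (reduced A) j                                         ≈⟨ dA′≋0 j ⟩
    0#                                                                  ∎) a

  weight-entry : ∀ {n} t (x : Vector Carrier n) → weight (entry t x ∘ columns n) ≡
    weigh t ℕ.+ (n ℕ.* weigh t ℕ.+ (n ℕ.* weigh t ℕ.+ (n ℕ.* weigh t ℕ.+ (weight x ℕ.+ (weight x ℕ.+ weight (λ i → x i + t))))))
  weight-entry {n} t x = ≡.cong (weigh t ℕ.+_)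
    (≡.trans (∑-++ f marks _) (≡.cong₂ ℕ._+_ (∑-const n (weigh t))
    (≡.trans (∑-++ f marks _) (≡.cong₂ ℕ._+_ (∑-const n (weigh t))
    (≡.trans (∑-++ f marks _) (≡.cong₂ ℕ._+_ (∑-const n (weigh t))
    (≡.trans (∑-++ f plain _) (≡.cong (weight x ℕ.+_)
    (∑-++ f plain link)))))))))
    where
    f : Column n → ℕ
    f = weigh ∘ entry t x

  -- All marks vanish, and the other three blocks have only n columns each.
  weight-entry-0 : ∀ {n t} (x : Vector Carrier n) → t ≈ 0# → weight (entry t x ∘ columns n) ℕ.≤ 3 ℕ.* n
  weight-entry-0 {n} {t} x t≈0 rewrite weight-entry t x | weigh-zero t≈0 | ℕ.*-zeroʳ n | ℕ.+-identityʳ n =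
    ℕ.+-mono-≤ (weight≤n x) (ℕ.+-mono-≤ (weight≤n x) (weight≤n _))

  weight-entry-≉0 : ∀ {n t} (x : Vector Carrier n) → ¬ t ≈ 0# → weight (entry t x ∘ columns n) ≡
    suc (3 ℕ.* n) ℕ.+ (weight x ℕ.+ weight x ℕ.+ weight (λ i → x i + t))
  weight-entry-≉0 {n} {t} x t≉0 rewrite weight-entry t x | weigh-nonzero t≉0 =
    solve 4 (λ n a b c → con 1 :+ (n :* con 1 :+ (n :* con 1 :+ (n :* con 1 :+ (a :+ (b :+ c))))) :=
                         con 1 :+ con 3 :* n :+ (a :+ b :+ c)) ≡.refl n (weight x) (weight x) _
    where open +-*-Solver

  -- The 3n + 1 marks and the n `link` entries `0# + 1#` are exactly the nonzero ones.
  weight-marker : ∀ n → weight (entry 1# (const 0#) ∘ columns n) ≡ suc (3 ℕ.* n) ℕ.+ n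
  weight-marker n = ≡.trans (weight-entry-≉0 {n} (const 0#) 1≉0) (≡.cong (suc (3 ℕ.* n) ℕ.+_)
    (≡.cong₂ ℕ._+_ (≡.cong₂ ℕ._+_ zeros zeros)
      (≡.trans (∑-cong {n} λ _ → weigh-nonzero (1≉0 ∘ trans (sym (+-identityˡ 1#)))) (≡.trans (∑-const n 1) (ℕ.*-identityʳ n)))))
    where
    zeros : weight {n} (const 0#) ≡ 0
    zeros = ≡.trans (∑-cong {n} λ _ → weigh-zero refl) (≡.trans (∑-const n 0) (ℕ.*-zeroʳ n))

  -- A nonzero xᵢ contributes 2 to the weights of the plain columns, which outweighs
  -- the entry xᵢ + t that it may annihilate.
  weight-minimal : ∀ {n t} (x : Vector Carrier n) → ¬ t ≈ 0# →
                   weight (entry t x ∘ columns n) ℕ.≤ suc (3 ℕ.* n) ℕ.+ n → x ≋ const 0#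
  weight-minimal {n} {t} x t≉0 w≤ i = decidable-stable (x i ≟ 0#) λ xᵢ≉0 →
    contradiction (≡.trans (≡.sym (weigh-nonzero xᵢ≉0)) (∑≡0 (weigh ∘ x) (ℕ.n≤0⇒n≡0 weight≤0) i)) λ ()
    where
    y : Vector Carrier n
    y i = x i + t

    pointwise : ∀ i → 1 ℕ.+ weigh (x i) ℕ.≤ weigh (x i) ℕ.+ weigh (x i) ℕ.+ weigh (y i)
    pointwise i with x i ≟ 0#
    ... | yes xᵢ≈0 = ℕ.≤-reflexive (≡.sym (weigh-nonzero λ y≈0 → t≉0 (trans (sym (+-identityˡ t)) (trans (+-congʳ (sym xᵢ≈0)) y≈0))))
    ... | no _     = s≤s (s≤s z≤n)

    n+weight≤ : n ℕ.+ weight x ℕ.≤ weight x ℕ.+ weight x ℕ.+ weight y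
    n+weight≤ = ≡.subst₂ ℕ._≤_
      (≡.trans (∑-distrib (const 1) (weigh ∘ x)) (≡.cong (ℕ._+ weight x) (≡.trans (∑-const n 1) (ℕ.*-identityʳ n))))
      (≡.trans (∑-distrib (λ i → weigh (x i) ℕ.+ weigh (x i)) (weigh ∘ y)) (≡.cong (ℕ._+ weight y) (∑-distrib (weigh ∘ x) (weigh ∘ x))))
      (∑-mono pointwise)

    weight≤0 : weight x ℕ.≤ 0
    -- After removal of the marks, the hypothesis bounds the remaining weight by `n`; together with
    -- `n+weight≤` this gives `n + weight x ≤ n + 0`.
    weight≤0 = ℕ.+-cancelˡ-≤ n _ _ (ℕ.≤-trans n+weight≤ (ℕ.≤-trans
      (ℕ.+-cancelˡ-≤ (suc (3 ℕ.* n)) _ _ (ℕ.≤-trans (ℕ.≤-reflexive (≡.sym (weight-entry-≉0 x t≉0))) w≤))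
      (ℕ.≤-reflexive (≡.sym (ℕ.+-identityʳ n)))))

  -- From permutation to monomial equivalence

  block : ∀ {k} → Matrix k k → Matrix (suc k) (suc k)
  block S zero    zero    = 1#
  block S zero    (suc b) = 0#
  block S (suc a) zero    = 0#
  block S (suc a) (suc b) = S a b

  block-inverse : ∀ {k} {S T : Matrix k k} → S ⊡ T ≋ᵐ identity → block S ⊡ block T ≋ᵐ identity
  block-inverse {k} {S} {T} ST≋1 = λ where
      zero    zero    → trans (+-cong (*-identityˡ 1#) (sum-0* λ l → 0#)) (+-identityʳ 1#)
      zero    (suc b) → trans (+-cong (zeroʳ 1#) (sum-0* λ l → T l b)) (+-identityʳ 0#)
      (suc a) zero    → trans (+-cong (zeroˡ 1#) (sum-*0 (S a))) (+-identityʳ 0#)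
      (suc a) (suc b) → trans (+-congʳ (zeroˡ 0#)) (trans (+-identityˡ _)
        (trans (ST≋1 a b) (reflexive (≡.sym (identity-suc a b)))))
    where
    sum-0* sum-*0 : ∀ (f : Vector Carrier k) → _
    sum-0* f = sum-zero {f = λ l → 0# * f l} (zeroˡ ∘ f)
    sum-*0 f = sum-zero {f = λ l → f l * 0#} (zeroʳ ∘ f)

  PermutationEquivalent MonomiallyEquivalent : ∀ {k n} → Matrix k n → Matrix k n → Set
  PermutationEquivalent G H = ∃[ S ] ∃[ P ] Invertible S × IsPermutationMatrix P × (S ⊡ G ⊡ P ≋ᵐ H)
  MonomiallyEquivalent  G H = ∃[ S ] ∃[ M ] Invertible S × IsMonomialMatrix M × (S ⊡ G ⊡ M ≋ᵐ H)

  entry-mapColumn : ∀ {n t} (x : Vector Carrier n) f c → entry t x (mapColumn f c) ≡ entry t (x ∘ f) c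
  entry-mapColumn x f mark      = ≡.refl
  entry-mapColumn x f (plain i) = ≡.refl
  entry-mapColumn x f (link i)  = ≡.refl

  -- `block S` leaves the marker row alone and acts as `S` on the data rows, while the given
  -- permutation is carried out within every block of columns. All scale factors are 1.
  reduction-complete : ∀ {k n} {G H : Matrix k n} → PermutationEquivalent G H → MonomiallyEquivalent (reduced G) (reduced H)
  reduction-complete {n = n} {G} {H} (S , P , (T , ST≋1 , TS≋1) , P-permutation , SGP≋H) =
      block S , permutationMatrix ρ
    , (block T , block-inverse {S = S} {T} ST≋1 , block-inverse {S = T} {S} TS≋1)
    , permutation⇒monomial (permutationMatrix-isPermutation ρ)
    , λ i j → trans (⊡-permutationMatrix (block S ⊡ reduced G) ρ i j) (trans (rows i (ρ ⟨$⟩ˡ j))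
        (reflexive (≡.cong (reduced H i) (Perm.inverseʳ ρ))))
    where
    open Monomial (permutation⇒monomial P-permutation)

    ρ = proj₁ (columns-realizes permutation)

    SG≈Hπ : ∀ a i → (S ⊡ G) a i ≈ H a (permutation ⟨$⟩ʳ i)
    SG≈Hπ a i = begin
      (S ⊡ G) a i                                    ≈⟨ *-identityʳ _ ⟨
      -- `scale i` is a nonzero entry of a permutation matrix, hence 1.
      (S ⊡ G) a i * 1#                               ≈⟨ *-congˡ (nonzero⇒one (proj₂ (proj₂ P-permutation) i _) (scale≉0 i)) ⟨
      (S ⊡ G) a i * scale i                          ≈⟨ ⊡-monomial (S ⊡ G) a i ⟨
      (S ⊡ G ⊡ P) a (permutation ⟨$⟩ʳ i)             ≈⟨ SGP≋H a (permutation ⟨$⟩ʳ i) ⟩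
      H a (permutation ⟨$⟩ʳ i)                       ∎

    columns-ρ : ∀ {t} (x : Vector Carrier n) j →
                entry t (x ∘ (permutation ⟨$⟩ʳ_)) (columns n j) ≡ entry t x (columns n (ρ ⟨$⟩ʳ j))
    columns-ρ {t} x j = ≡.trans (≡.sym (entry-mapColumn x (permutation ⟨$⟩ʳ_) (columns n j)))
      (≡.cong (entry t x) (≡.sym (proj₂ (columns-realizes permutation) j)))

    rows : ∀ i j → (block S ⊡ reduced G) i j ≈ reduced H i (ρ ⟨$⟩ʳ j)
    rows zero j = begin
      combination (block S zero) (reduced G) j                     ≈⟨ combination-reduced (block S zero) G j ⟩
      entry 1# (combination (const 0#) G) (columns n j)            ≈⟨ entry-cong refl (combination-zero {A = G} λ _ → refl) (columns n j) ⟩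
      entry 1# (const 0#) (columns n j)                            ≡⟨ columns-ρ (const 0#) j ⟩
      reduced H zero (ρ ⟨$⟩ʳ j)                                    ∎
    rows (suc a) j = begin
      combination (block S (suc a)) (reduced G) j                  ≈⟨ combination-reduced (block S (suc a)) G j ⟩
      entry 0# ((S ⊡ G) a) (columns n j)                           ≈⟨ entry-cong refl (SG≈Hπ a) (columns n j) ⟩
      entry 0# (H a ∘ (permutation ⟨$⟩ʳ_)) (columns n j)           ≡⟨ columns-ρ (H a) j ⟩
      reduced H (suc a) (ρ ⟨$⟩ʳ j)                                 ∎

  -- From monomial to permutation equivalence

  -- In a `plain` column the marker row is zero and leaves the scale factor free, so the data there
  -- are replaced by 0. The `plain` columns then cancel along with the marks.
  linkPart : ∀ {n} → Vector Carrier n → Column n → Carrier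
  linkPart x mark      = 0#
  linkPart x (plain i) = 0#
  linkPart x (link i)  = x i

  -- The marker row decides which columns can correspond: a scaled `t` is never 0 and a scaled 0 is
  -- never 1, so `plain` columns go exactly to `plain` columns. Elsewhere `t * l` is 1, and scaling
  -- by `l` undoes the factor `t` between `x` and `y`.
  linkPart-match : ∀ {k n t l} {x y z : Matrix k n} → ¬ t ≈ 0# → ¬ l ≈ 0# → (∀ a i → x a i ≈ t * y a i) →
                   ∀ c c′ → entry t (const 0#) c * l ≈ entry 1# (const 0#) c′ →
                   (∀ a → entry 0# (x a) c * l ≈ entry 0# (z a) c′) →
                   ∀ a → linkPart (y a) c ≈ linkPart (z a) c′
  linkPart-match {t = t} {l} {x} {y} {z} t≉0 l≉0 x≈ty = match
    where
    0l≉1 : ∀ {u} → u ≈ 1# → ¬ 0# * l ≈ u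
    0l≉1 u≈1 0l≈u = 1≉0 (sym (trans (sym (zeroˡ l)) (trans 0l≈u u≈1)))

    scaled : ∀ a i → (0# + t) * l ≈ 1# → y a i ≈ (x a i + 0#) * l
    scaled a i tl≈1 = begin
      y a i                 ≈⟨ *-identityˡ _ ⟨
      1# * y a i            ≈⟨ *-congʳ (trans (*-congʳ (sym (+-identityˡ t))) tl≈1) ⟨
      t * l * y a i         ≈⟨ *-assoc t l (y a i) ⟩
      t * (l * y a i)       ≈⟨ *-congˡ (*-comm l (y a i)) ⟩
      t * (y a i * l)       ≈⟨ *-assoc t (y a i) l ⟨
      t * y a i * l         ≈⟨ *-congʳ (trans (+-identityʳ _) (x≈ty a i)) ⟨
      (x a i + 0#) * l      ∎

    match : ∀ c c′ → entry t (const 0#) c * l ≈ entry 1# (const 0#) c′ →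
            (∀ a → entry 0# (x a) c * l ≈ entry 0# (z a) c′) → ∀ a → linkPart (y a) c ≈ linkPart (z a) c′
    match mark      mark      tl≈1 eq a = refl
    match mark      (plain j) tl≈0 eq a = contradiction tl≈0 (*-nonzero t≉0 l≉0)
    -- A mark may land on a `link` column, but the data arriving there are a scaled 0, so that
    -- column of `z` is zero.
    match mark      (link j)  tl≈1 eq a = trans (sym (zeroˡ l)) (trans (eq a) (+-identityʳ _))
    match (plain i) mark      0l≈1 eq a = contradiction 0l≈1 (0l≉1 refl)
    match (plain i) (plain j) 0l≈0 eq a = refl
    match (plain i) (link j)  0l≈1 eq a = contradiction 0l≈1 (0l≉1 (+-identityˡ 1#))
    match (link i)  mark      tl≈1 eq a = trans (scaled a i tl≈1) (eq a)
    match (link i)  (plain j) tl≈0 eq a = contradiction (trans (*-congʳ (sym (+-identityˡ t))) tl≈0) (*-nonzero t≉0 l≉0)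
    match (link i)  (link j)  tl≈1 eq a = trans (scaled a i (trans tl≈1 (+-identityˡ 1#))) (trans (eq a) (+-identityʳ _))

  columnSetoid : ℕ → Setoid 0ℓ 0ℓ
  columnSetoid k = record
    { Carrier       = Vector Carrier k
    ; _≈_           = _≋_
    ; isEquivalence = record
      { refl = λ _ → refl ; sym = λ v≋w i → sym (v≋w i) ; trans = λ u≋v v≋w i → trans (u≋v i) (v≋w i) }
    }

  module _ {k n} {H : Matrix k n} where

    open Cancellation (columnSetoid k)

    -- `linkPart` is zero for both matrices on the first 5n + 1 positions, so these can be cancelled
    -- block by block until the `link` block is left.
    cancel-columns : ∀ {K : Matrix k n} (π : Permutation′ (reducedLength n)) →
                     (∀ j a → linkPart (K a) (columns n j) ≈ linkPart (H a) (columns n (π ⟨$⟩ʳ j))) →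
                     Σ[ ρ ∈ Permutation′ n ] (∀ i a → K a i ≈ H a (ρ ⟨$⟩ʳ i))
    cancel-columns {K} π eq =
      let π₁ , eq₁ = cancel-head {f = φ ∘ columns n} {ψ ∘ columns n} π eq (λ _ → refl)
          π₂ , eq₂ = cancel-++ φ ψ marks _ (λ _ _ → refl) π₁ eq₁
          π₃ , eq₃ = cancel-++ φ ψ marks _ (λ _ _ → refl) π₂ eq₂
          π₄ , eq₄ = cancel-++ φ ψ marks _ (λ _ _ → refl) π₃ eq₃
          π₅ , eq₅ = cancel-++ φ ψ plain _ (λ _ _ → refl) π₄ eq₄
      in cancel-++ φ ψ plain link (λ _ _ → refl) π₅ eq₅
      where
      φ ψ : Column n → Vector Carrier k
      φ c a = linkPart (K a) c
      ψ c a = linkPart (H a) c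

  reduction-sound : ∀ {k n} {G H : Matrix k n} → LinearlyIndependent G →
                    MonomiallyEquivalent (reduced G) (reduced H) → PermutationEquivalent G H
  reduction-sound {k} {n} {G} {H} independent (S , M , (T , ST≋1 , TS≋1) , M-monomial , SGM≋H) =
      S₀ , permutationMatrix ρ , (T₀ , S₀T₀≋1 , T₀S₀≋1) , permutationMatrix-isPermutation ρ
    , λ a i → trans (⊡-permutationMatrix (S₀ ⊡ G) ρ a i)
        (trans (K≈Hρ (ρ ⟨$⟩ˡ i) a) (reflexive (≡.cong (H a) (Perm.inverseʳ ρ))))
    where
    open Monomial M-monomial

    t : Carrier
    t = S zero zero

    rows : ∀ i j → entry (S i zero) (combination (S i ∘ suc) G) (columns n j) * scale j ≈ reduced H i (permutation ⟨$⟩ʳ j)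
    rows i j = begin
      entry (S i zero) (combination (S i ∘ suc) G) (columns n j) * scale j   ≈⟨ *-congʳ (combination-reduced (S i) G j) ⟨
      (S ⊡ reduced G) i j * scale j                                          ≈⟨ ⊡-monomial (S ⊡ reduced G) i j ⟨
      (S ⊡ reduced G ⊡ M) i (permutation ⟨$⟩ʳ j)                             ≈⟨ SGM≋H i (permutation ⟨$⟩ʳ j) ⟩
      reduced H i (permutation ⟨$⟩ʳ j)                                       ∎

    weight-row : ∀ i → weight (entry (S i zero) (combination (S i ∘ suc) G) ∘ columns n) ≡ weight (reduced H i)
    weight-row i = weight-monomial {w = reduced H i} permutation scale≉0 (rows i)

    t≉0 : ¬ t ≈ 0#
    -- Otherwise a combination of weight at most 3n would be sent to the marker row, of weight 4n +
    -- 1.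
    t≉0 t≈0 = ℕ.<⇒≱ (s≤s (ℕ.m≤m+n (3 ℕ.* n) n)) (ℕ.≤-trans
      (ℕ.≤-reflexive (≡.trans (≡.sym (weight-marker n)) (≡.sym (weight-row zero)))) (weight-entry-0 (combination (S zero ∘ suc) G) t≈0))

    S₀ₛ≈0 : ∀ b → S zero (suc b) ≈ 0#
    -- The marker row of `reduced H` attains the minimum 4n + 1, which forces the data part to be 0;
    -- the independence of `G` passes this on to the coefficients.
    S₀ₛ≈0 = independent (S zero ∘ suc) (weight-minimal _ t≉0 (ℕ.≤-reflexive (≡.trans (weight-row zero) (weight-marker n))))

    A : Matrix k n
    A a = combination (S (suc a) ∘ suc) G

    Sₛ₀≈0 : ∀ a → S (suc a) zero ≈ 0#
    -- A data row of `reduced H` has weight at most 3n, too little for a combination that involves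
    -- the marker row.
    Sₛ₀≈0 a = decidable-stable (S (suc a) zero ≟ 0#) λ s≉0 → ℕ.<⇒≱ (s≤s (ℕ.m≤m+n (3 ℕ.* n) _)) (ℕ.≤-trans
      (ℕ.≤-reflexive (≡.trans (≡.sym (weight-entry-≉0 (A a) s≉0)) (weight-row (suc a)))) (weight-entry-0 (H a) refl))

    t⁻¹ : Carrier
    t⁻¹ = proj₁ (inverse t t≉0)

    tt⁻¹≈1 : t * t⁻¹ ≈ 1#
    tt⁻¹≈1 = proj₂ (inverse t t≉0)

    -- The marked columns are scaled by 1 / `t`, and this factor is moved into the row
    -- transformation. In each of the two products below, the extra term contains a vanishing
    -- off-diagonal entry of `S`.
    S₀ T₀ : Matrix k k
    S₀ a b = t⁻¹ * S (suc a) (suc b)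
    T₀ a b = t * T (suc a) (suc b)

    unscale : ∀ x y → t * x * (t⁻¹ * y) ≈ x * y
    unscale x y = trans (*-interchange t x t⁻¹ y) (trans (*-congʳ tt⁻¹≈1) (*-identityˡ _))

    S₀T₀≋1 : S₀ ⊡ T₀ ≋ᵐ identity
    S₀T₀≋1 a b = begin
      sum (λ l → t⁻¹ * S (suc a) (suc l) * (t * T (suc l) (suc b)))   ≈⟨ sum-cong-≋ (λ l → trans (*-comm _ _) (trans (unscale (T (suc l) (suc b)) (S (suc a) (suc l))) (*-comm _ _))) ⟩
      sum (λ l → S (suc a) (suc l) * T (suc l) (suc b))               ≈⟨ +-identityˡ _ ⟨
      0# + sum (λ l → S (suc a) (suc l) * T (suc l) (suc b))          ≈⟨ +-congʳ (trans (*-congʳ (Sₛ₀≈0 a)) (zeroˡ _)) ⟨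
      (S ⊡ T) (suc a) (suc b)                                         ≈⟨ ST≋1 (suc a) (suc b) ⟩
      identity (suc a) (suc b)                                        ≡⟨ identity-suc a b ⟩
      identity a b                                                    ∎

    T₀S₀≋1 : T₀ ⊡ S₀ ≋ᵐ identity
    T₀S₀≋1 a b = begin
      sum (λ l → t * T (suc a) (suc l) * (t⁻¹ * S (suc l) (suc b)))   ≈⟨ sum-cong-≋ (λ l → unscale (T (suc a) (suc l)) (S (suc l) (suc b))) ⟩
      sum (λ l → T (suc a) (suc l) * S (suc l) (suc b))               ≈⟨ +-identityˡ _ ⟨
      0# + sum (λ l → T (suc a) (suc l) * S (suc l) (suc b))          ≈⟨ +-congʳ (trans (*-congˡ (S₀ₛ≈0 b)) (zeroʳ _)) ⟨
      (T ⊡ S) (suc a) (suc b)                                         ≈⟨ TS≋1 (suc a) (suc b) ⟩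
      identity (suc a) (suc b)                                        ≡⟨ identity-suc a b ⟩
      identity a b                                                    ∎

    A≈tK : ∀ a i → A a i ≈ t * (S₀ ⊡ G) a i
    A≈tK a i = begin
      A a i                           ≈⟨ *-identityˡ _ ⟨
      1# * A a i                      ≈⟨ *-congʳ tt⁻¹≈1 ⟨
      t * t⁻¹ * A a i                 ≈⟨ *-assoc t t⁻¹ (A a i) ⟩
      t * (t⁻¹ * A a i)               ≈⟨ *-congˡ (combination-* t⁻¹ (S (suc a) ∘ suc) G i) ⟨
      t * (S₀ ⊡ G) a i                ∎

    cancelled : Σ[ ρ ∈ Permutation′ n ] (∀ i a → (S₀ ⊡ G) a i ≈ H a (ρ ⟨$⟩ʳ i))
    cancelled = cancel-columns {H = H} {K = S₀ ⊡ G} permutation λ j →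
      linkPart-match t≉0 (scale≉0 j) A≈tK (columns n j) (columns n (permutation ⟨$⟩ʳ j))
        -- The off-diagonal entries of `S` are replaced by 0, so that the marker row carries no data
        -- and the data rows no marker.
        (trans (*-congʳ (entry-cong refl (λ i → sym (combination-zero {A = G} S₀ₛ≈0 i)) (columns n j))) (rows zero j))
        (λ a → trans (*-congʳ (entry-cong (sym (Sₛ₀≈0 a)) (λ _ → refl) (columns n j))) (rows (suc a) j))

    ρ = proj₁ cancelled
    K≈Hρ = proj₂ cancelled

-- Counting vectors over a finite field

module FiniteVectors (Φ : FiniteField) where

  open FiniteField Φ using (F; p; m; q; prime; evaluate; coordinates; coordinates-cong; evaluate-coordinates; coordinates-evaluate)
  open Field F hiding (zero)
  open LinearAlgebra F

  infix 4 _≟_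
  -- Field elements are compared through their coordinate vectors, which determine them.
  _≟_ : Decidable _≈_
  x ≟ y = map′ (λ eq → trans (sym (evaluate-coordinates x)) (trans (reflexive (≡.cong evaluate eq)) (evaluate-coordinates y)))
    coordinates-cong (Vec.≡-dec Fin._≟_ (coordinates x) (coordinates y))

  open FieldAlgebra F _≟_ public

  private
    index : Carrier → Fin q
    index x = funToFin (Vec.lookup (coordinates x))

    element : Fin q → Carrier
    element i = evaluate (Vec.tabulate (finToFun i))

    element-index : ∀ x → element (index x) ≈ x
    element-index x = trans (reflexive (≡.cong evaluate (≡.trans (Vec.tabulate-cong (Fin.finToFun-funToFin (Vec.lookup (coordinates x))))
      (Vec.tabulate∘lookup (coordinates x))))) (evaluate-coordinates x)

    index-element : ∀ i → index (element i) ≡ i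
    index-element i = ≡.trans (funToFin-cong λ j → ≡.trans
      (≡.cong (λ v → Vec.lookup v j) (coordinates-evaluate (Vec.tabulate (finToFun i)))) (Vec.lookup∘tabulate (finToFun i) j))
      (Fin.funToFin-finToFin {m} i)

    vectorIndex : ∀ {k} → Vector Carrier k → Fin (q ℕ.^ k)
    vectorIndex v = funToFin (index ∘ v)

    vector : ∀ {k} → Fin (q ℕ.^ k) → Vector Carrier k
    vector i = element ∘ finToFun i

    vector-index : ∀ {k} (v : Vector Carrier k) → vector (vectorIndex v) ≋ v
    vector-index v j = trans (reflexive (≡.cong element (Fin.finToFun-funToFin (index ∘ v) j))) (element-index (v j))

    index-vector : ∀ {k} (i : Fin (q ℕ.^ k)) → vectorIndex (vector {k} i) ≡ i
    index-vector {k} i = ≡.trans (funToFin-cong {k} λ j → index-element (finToFun i j)) (Fin.funToFin-finToFin {k} i)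

    vectorIndex-cong : ∀ {k} {v w : Vector Carrier k} → v ≋ w → vectorIndex v ≡ vectorIndex w
    vectorIndex-cong v≋w = funToFin-cong λ j → ≡.cong (funToFin ∘ Vec.lookup) (coordinates-cong (v≋w j))

    vectorIndex-injective : ∀ {k} {v w : Vector Carrier k} → vectorIndex v ≡ vectorIndex w → v ≋ w
    vectorIndex-injective {k} {v} {w} eq j =
      trans (sym (vector-index v j)) (trans (reflexive (≡.cong (λ i → vector {k} i j) eq)) (vector-index w j))

  module _ {k n} {f : Vector Carrier k → Vector Carrier n} (injective : ∀ {v w} → f v ≋ f w → v ≋ w) where

    onIndices : Fin (q ℕ.^ k) → Fin (q ℕ.^ n)
    onIndices = vectorIndex ∘ f ∘ vector {k}

    onIndices-injective : Injective _≡_ _≡_ onIndices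
    onIndices-injective {i} {j} eq = ≡.trans (≡.sym (index-vector {k} i))
      (≡.trans (vectorIndex-cong (injective (vectorIndex-injective {n} eq))) (index-vector {k} j))

    injective⇒dimension≤ : 1 ℕ.< q → k ℕ.≤ n
    injective⇒dimension≤ 1<q = ℕ.≮⇒≥ λ n<k → ℕ.<⇒≱ (ℕ.^-monoʳ-< q 1<q n<k) (Fin.injective⇒≤ onIndices-injective)

  module _ {k} {f : Vector Carrier k → Vector Carrier k} (injective : ∀ {v w} → f v ≋ f w → v ≋ w) where

    -- The vectors are indexed by a finite set of `q ^ k` elements, so the pigeonhole principle
    -- takes the place of rank arguments.
    injective⇒onto : ∀ w → ∃[ v ] f v ≋ w
    injective⇒onto w with injective⇒surjective (onIndices-injective injective) (vectorIndex w)
    ... | i , eq = vector {k} i , vectorIndex-injective eq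

  -- Writing the basis B of the code as T G, the map c ↦ c T is injective, hence onto.
  generator⇒independent : ∀ {k n} {G : Matrix k n} → IsGenerator G → LinearlyIndependent G
  generator⇒independent {k} {n} {G} (C , (B , B∈C , B-independent , _) , C⇔span) c cG≋0 i = begin
    c i                                      ≈⟨ proj₂ c≋dT i ⟨
    combination (proj₁ c≋dT) T i             ≈⟨ combination-zero {A = T} (B-independent _ λ j → begin
      combination (proj₁ c≋dT) B j                       ≈⟨ combination-⊡-B (proj₁ c≋dT) j ⟩
      combination (combination (proj₁ c≋dT) T) G j       ≈⟨ combination-cong {A = G} (proj₂ c≋dT) (λ _ _ → refl) j ⟩
      combination c G j                                  ≈⟨ cG≋0 j ⟩
      0#                                                 ∎) i ⟩
    0#                                       ∎
    where
    open import Relation.Binary.Reasoning.Setoid setoid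

    T : Matrix k k
    T i = proj₁ (Equivalence.to (C⇔span (B i)) (B∈C i))

    combination-⊡-B : ∀ d → combination d B ≋ combination (combination d T) G
    combination-⊡-B d j = trans (combination-cong {A = B} (λ _ → refl) (λ i l → sym (proj₂ (Equivalence.to (C⇔span (B i)) (B∈C i)) l)) j)
      (combination-⊡ d T G j)

    T-independent : LinearlyIndependent T
    T-independent d dT≋0 = B-independent d λ j → trans (combination-⊡-B d j) (combination-zero {A = G} dT≋0 j)

    c≋dT : ∃[ d ] combination d T ≋ c
    c≋dT = injective⇒onto (independent⇒injective {A = T} T-independent) c

-- Programs and their running times

open import Data.Nat.Base
open import Data.Nat.Properties
open import Relation.Binary.PropositionalEquality using (refl; sym; trans; cong; cong₂; subst; subst₂; module ≡-Reasoning)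

run-+ : ∀ {s} t u (c : Configuration s) → run (t + u) c ≡ run u (run t c)
run-+ zero    u c = refl
run-+ (suc t) u c = run-+ t u (step c)

infix 4 _⊢_⇒_within_

-- Quantifying over the continuation `K` makes runs composable under `++` and inside loops. The
-- exact time is kept apart from its bound because `run` needs an exact number of steps.
record _⊢_⇒_within_ {s} (P : Program s) (σ τ : Store s) (t : ℕ) : Set where
  constructor runs
  field
    time  : ℕ
    bound : time ≤ t
    trace : ∀ K → run time (P ++ K , σ) ≡ (K , τ)

weaken : ∀ {s P t u} {σ τ : Store s} → t ≤ u → P ⊢ σ ⇒ τ within t → P ⊢ σ ⇒ τ within u
weaken t≤u (runs t b r) = runs t (≤-trans b t≤u) r

sequence : ∀ {s P Q t u} {σ τ υ : Store s} →
           P ⊢ σ ⇒ τ within t → Q ⊢ τ ⇒ υ within u → P ++ Q ⊢ σ ⇒ υ within (t + u)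
sequence {P = P} {Q} {σ = σ} {τ} {υ} (runs t t≤ p) (runs u u≤ q) = runs (t + u) (+-mono-≤ t≤ u≤) λ K → begin
  run (t + u) ((P ++ Q) ++ K , σ)       ≡⟨ cong (λ R → run (t + u) (R , σ)) (List.++-assoc P Q K) ⟩
  run (t + u) (P ++ Q ++ K , σ)         ≡⟨ run-+ t u _ ⟩
  run u (run t (P ++ Q ++ K , σ))       ≡⟨ cong (run u) (p (Q ++ K)) ⟩
  run u (Q ++ K , τ)                    ≡⟨ q K ⟩
  (K , υ)                               ∎
  where open ≡-Reasoning

while-true : ∀ {s i b P t} {σ τ υ : Store s} → b (top σ i) ≡ true →
             P ⊢ σ ⇒ τ within t → ∀ {u} → [ while i b P ] ⊢ τ ⇒ υ within u →
             [ while i b P ] ⊢ σ ⇒ υ within (suc t + u)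
while-true {i = i} {b} {P} {σ = σ} {τ} {υ} true≡ (runs t t≤ p) (runs u u≤ q) =
  runs (suc t + u) (s≤s (+-mono-≤ t≤ u≤)) trace
  where
  open ≡-Reasoning
  trace : ∀ K → run (suc t + u) (while i b P ∷ K , σ) ≡ (K , υ)
  trace K rewrite true≡ = begin
    run (t + u) (P ++ while i b P ∷ K , σ)      ≡⟨ run-+ t u _ ⟩
    run u (run t (P ++ while i b P ∷ K , σ))    ≡⟨ cong (run u) (p _) ⟩
    run u (while i b P ∷ K , τ)                 ≡⟨ q K ⟩
    (K , υ)                                     ∎

while-false : ∀ {s i b P} {σ : Store s} → b (top σ i) ≡ false → [ while i b P ] ⊢ σ ⇒ σ within 1
while-false {i = i} {b} {P} {σ} false≡ = runs 1 ≤-refl trace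
  where
  trace : ∀ K → run 1 (while i b P ∷ K , σ) ≡ (K , σ)
  trace K rewrite false≡ = refl

module _ {s} {A B : Set} (Valid : A → Set) (st : List A → B → Store s) (update : B → A → B)
  {i : Fin s} {b : Maybe Symbol → Bool} {P : Program s} {t : ℕ}
  (continue : ∀ {a} → Valid a → ∀ as y → b (top (st (a ∷ as) y) i) ≡ true)
  (finish : ∀ y → b (top (st [] y) i) ≡ false)
  (body : ∀ {a} → Valid a → ∀ as y → P ⊢ st (a ∷ as) y ⇒ st as (update y a) within t)
  where

  -- `st as y` is the loop invariant, with `as` still to be read and `y` the result so far. Every
  -- item pays for the body and one test; the final 1 is the failing test.
  while-list : ∀ {as} → All Valid as → ∀ y →
               [ while i b P ] ⊢ st as y ⇒ st [] (foldl update y as) within (length as * suc t + 1)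
  while-list [] y = while-false (finish y)
  while-list {a ∷ as} (v ∷ vs) y = weaken (≤-reflexive (sym (+-assoc (suc t) _ 1)))
    (while-true (continue v as y) (body v as y) (while-list vs _))

-- Moving symbols between stacks

consume : ∀ {s} → Fin s → (Symbol → Program s) → Maybe Symbol → Program s
consume i f nothing  = []
consume i f (just a) = pop i ∷ f a

move : ∀ {s} → Fin s → (Maybe Symbol → Bool) → (Symbol → Program s) → Program s
move i b f = [ while i b [ branch i (consume i f) ] ]

module _ {s} (i : Fin s) (b : Maybe Symbol → Bool) (f : Symbol → Program s) (st : List Symbol → List Symbol → Store s)
  {t : ℕ} (rest : List Symbol)
  (source : ∀ x y → Vec.lookup (st x y) i ≡ x)
  (finish : b (List.head rest) ≡ false)
  (body : ∀ a x y → pop i ∷ f a ⊢ st (a ∷ x) y ⇒ st x (a ∷ y) within t)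
  where

  -- Moving reverses the order, hence `ʳ++`. Besides the body, each symbol costs one loop test and
  -- one `branch`.
  move-runs : ∀ {l} → All (λ a → b (just a) ≡ true) l → ∀ y →
              move i b f ⊢ st (l ++ rest) y ⇒ st rest (l ʳ++ y) within (length l * suc (suc t) + 1)
  move-runs = while-list _ (λ l → st (l ++ rest)) _
    (λ v as y → trans (cong (λ l → b (List.head l)) (source _ y)) v)
    (λ y → trans (cong (λ l → b (List.head l)) (source rest y)) finish)
    (λ {a} _ as y → step-branch (cong List.head (source _ y)) (body a _ y))
    where
    step-branch : ∀ {a σ τ} → top σ i ≡ just a → pop i ∷ f a ⊢ σ ⇒ τ within t →
                  [ branch i (consume i f) ] ⊢ σ ⇒ τ within suc t
    step-branch {a} {σ} {τ} eq (runs u u≤ r) = runs (suc u) (s≤s u≤) trace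
      where
      trace : ∀ K → run (suc u) (branch i (consume i f) ∷ K , σ) ≡ (K , τ)
      trace K rewrite eq = r K

module _ {s} (i : Fin s) (f : Symbol → Program s) (st : List Symbol → List Symbol → Store s) {t : ℕ}
  (source : ∀ x y → Vec.lookup (st x y) i ≡ x)
  (body : ∀ a x y → pop i ∷ f a ⊢ st (a ∷ x) y ⇒ st x (a ∷ y) within t)
  where

  move-all : ∀ l y → move i is-just f ⊢ st l y ⇒ st [] (l ʳ++ y) within (length l * suc (suc t) + 1)
  move-all l y = subst (λ x → move i is-just f ⊢ st x y ⇒ st [] (l ʳ++ y) within (length l * suc (suc t) + 1))
    (List.++-identityʳ l) (move-runs i is-just f st [] source refl body (All.universal (λ _ → refl) l) y)

-- The machine

-- An empty stack counts as lying before the terminator. Encodings contain every terminator, so on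
-- them the loops stop.
beforeCoefficient beforeElement beforeRow beforeMatrix : Maybe Symbol → Bool
beforeCoefficient (just endCoefficient) = false
beforeCoefficient _                     = true
beforeElement (just endElement) = false
beforeElement _                 = true
beforeRow (just endRow) = false
beforeRow _             = true
beforeMatrix (just endMatrix) = false
beforeMatrix _                = true

-- The modulus is written like a field element, so clearing its bits yields the string of 0 in a
-- field that is known only from the input.
zeroed : Symbol → Symbol
zeroed (bit _) = bit false
zeroed a       = a

-- Stack 0 holds the rest of the input and stack 1 the output so far, last symbol
-- first; stack 2 is scratch, 3 holds the current row, 4 and 5 rows of n zeros and
-- n ones, and 6 the element 0.
copyUntil : (Maybe Symbol → Bool) → Symbol → Program 7
copyUntil b e = move 0F b (λ a → push 1F a ∷ []) ++ pop 0F ∷ push 1F e ∷ []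

-- Reading a stack destroys it; a second copy on the scratch stack restores it, in the original
-- order after two reversals.
emit : Fin 7 → Program 7
emit i = move i is-just (λ a → push 1F a ∷ push 2F a ∷ []) ++ move 2F is-just (λ a → push i a ∷ [])

readModulus : Program 7
readModulus =
  move 0F beforeElement (λ a → push 1F a ∷ push 2F (zeroed a) ∷ []) ++
  (pop 0F ∷ push 1F endElement ∷ push 2F endElement ∷ []) ++
  move 2F is-just (λ a → push 6F a ∷ [])

-- One unary digit of `n` becomes six digits of the new blocklength 6n + 1.
sixBits : Program 7
sixBits = List.replicate 6 (push 1F (bit true))

readBit : Program 7
readBit =
  (pop 0F ∷ sixBits) ++
  move 6F is-just (λ a → push 2F a ∷ []) ++
  move 2F is-just (λ a → push 6F a ∷ push 4F a ∷ push 5F a ∷ []) ++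
  -- The top of stack 5 is the lowest bit of the constant coefficient of a fresh 0; setting it gives
  -- the element 1.
  (pop 5F ∷ push 5F (bit true) ∷ [])

readBlocklength : Program 7
readBlocklength =
  -- The summand 1 of the blocklength 6n + 1.
  [ push 1F (bit true) ] ++
  [ while 0F beforeElement readBit ] ++
  (pop 0F ∷ push 1F endElement ∷ [])

markerRow : Program 7
markerRow =
  -- The stored 0 is turned into 1 for a single output and then reset.
  (pop 6F ∷ push 6F (bit true) ∷ []) ++ emit 6F ++ (pop 6F ∷ push 6F (bit false) ∷ []) ++
  emit 5F ++ emit 5F ++ emit 5F ++ emit 4F ++ emit 4F ++ emit 5F ++ [ push 1F endRow ]

transformRow : Program 7
transformRow =
  move 0F beforeRow (λ a → push 2F a ∷ []) ++ [ pop 0F ] ++ move 2F is-just (λ a → push 3F a ∷ []) ++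
  emit 6F ++ emit 4F ++ emit 4F ++ emit 4F ++ emit 3F ++ emit 3F ++ emit 3F ++ [ push 1F endRow ] ++
  -- The buffer is emptied for the next row.
  move 3F is-just (λ _ → [])

transformMatrix : Program 7
transformMatrix =
  markerRow ++ [ while 0F beforeMatrix transformRow ] ++ (pop 0F ∷ push 1F endMatrix ∷ [])

transformAll : Program 7
transformAll =
  copyUntil beforeCoefficient endCoefficient ++ readModulus ++
  -- The extra digit accounts for the marker row in the dimension k + 1.
  ([ push 1F (bit true) ] ++ copyUntil beforeElement endElement) ++ readBlocklength ++
  transformMatrix ++ transformMatrix

reduction : Program 7
reduction = transformAll ++ move 1F is-just (λ a → push 0F a ∷ [])

⟨_,_,_,_,_,_,_⟩ : (x o t r z u e : List Symbol) → Store 7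
⟨ x , o , t , r , z , u , e ⟩ = x ∷ o ∷ t ∷ r ∷ z ∷ u ∷ e ∷ []

-- Polynomial cost bounds

module Cost (Y : ℕ) .{{_ : NonZero Y}} where

  infix 4 _⊢_⇒_costs_·Y^_

  -- With all lengths measured against one `Y`, constants add up under `⨾` and degrees are equalized
  -- by `raise`.
  record _⊢_⇒_costs_·Y^_ {s} (P : Program s) (σ τ : Store s) (c d : ℕ) : Set where
    constructor costs
    field within : P ⊢ σ ⇒ τ within (c * Y ^ d)

  open _⊢_⇒_costs_·Y^_ public

  Y^-mono : ∀ {d e} → d ≤ e → Y ^ d ≤ Y ^ e
  Y^-mono = ^-monoʳ-≤ Y

  exactly : ∀ {s t} {σ τ : Store s} P d → P ⊢ σ ⇒ τ within t → P ⊢ σ ⇒ τ costs t ·Y^ d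
  exactly {t = t} P d r = costs (weaken (≤-trans (≤-reflexive (sym (*-identityʳ t))) (*-monoʳ-≤ t (Y^-mono {0} {d} z≤n))) r)

  raise : ∀ {s P c d e} {σ τ : Store s} → d ≤ e → P ⊢ σ ⇒ τ costs c ·Y^ d → P ⊢ σ ⇒ τ costs c ·Y^ e
  raise {c = c} d≤e (costs r) = costs (weaken (*-monoʳ-≤ c (Y^-mono d≤e)) r)

  infixr 5 _⨾_
  _⨾_ : ∀ {s P Q c e d} {σ τ υ : Store s} →
        P ⊢ σ ⇒ τ costs c ·Y^ d → Q ⊢ τ ⇒ υ costs e ·Y^ d → P ++ Q ⊢ σ ⇒ υ costs (c + e) ·Y^ d
  _⨾_ {c = c} {e} {d} (costs p) (costs q) =
    costs (weaken (≤-reflexive (sym (*-distribʳ-+ (Y ^ d) c e))) (sequence p q))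

  linear : ∀ {s P l t d} {σ τ : Store s} → l ≤ Y ^ d →
           P ⊢ σ ⇒ τ within (l * t + 1) → P ⊢ σ ⇒ τ costs suc t ·Y^ d
  linear {l = l} {t} {d} l≤ r = costs (weaken bound r)
    where
    open ≤-Reasoning
    bound = begin
      l * t + 1           ≤⟨ +-mono-≤ (*-monoˡ-≤ t l≤) (Y^-mono {0} {d} z≤n) ⟩
      Y ^ d * t + Y ^ d   ≡⟨ +-comm (Y ^ d * t) (Y ^ d) ⟩
      Y ^ d + Y ^ d * t   ≡⟨ cong (Y ^ d +_) (*-comm (Y ^ d) t) ⟩
      suc t * Y ^ d       ∎

  module _ {s} {A B : Set} (Valid : A → Set) (st : List A → B → Store s) (update : B → A → B)
    {i : Fin s} {b : Maybe Symbol → Bool} {P : Program s} {c d : ℕ}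
    (continue : ∀ {a} → Valid a → ∀ as y → b (top (st (a ∷ as) y) i) ≡ true)
    (finish : ∀ y → b (top (st [] y) i) ≡ false)
    (body : ∀ {a} → Valid a → ∀ as y → P ⊢ st (a ∷ as) y ⇒ st as (update y a) costs c ·Y^ d)
    where

    -- At most `Y` rounds raise the degree by one. Of the added 2, one part pays for the tests
    -- within the rounds and one for the last test.
    while-costs : ∀ {as} → length as ≤ Y → All Valid as → ∀ y →
                  [ while i b P ] ⊢ st as y ⇒ st [] (foldl update y as) costs (2 + c) ·Y^ suc d
    while-costs {as} l≤ vs y = costs (weaken bound
      (while-list Valid st update continue finish (λ v as y → within (body v as y)) vs y))
      where
      open ≤-Reasoning
      X = Y ^ d
      bound = begin
        length as * suc (c * X) + 1    ≤⟨ +-mono-≤ (*-mono-≤ l≤ (+-monoˡ-≤ (c * X) (Y^-mono {0} {d} z≤n))) (Y^-mono {0} {suc d} z≤n) ⟩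
        Y * (suc c * X) + Y * X        ≡⟨ *-distribˡ-+ Y (suc c * X) X ⟨
        Y * (suc c * X + X)            ≡⟨ cong (Y *_) (+-comm (suc c * X) X) ⟩
        Y * ((2 + c) * X)              ≡⟨ *-assoc Y (2 + c) X ⟨
        Y * (2 + c) * X                ≡⟨ cong (_* X) (*-comm Y (2 + c)) ⟩
        (2 + c) * Y * X                ≡⟨ *-assoc (2 + c) Y X ⟩
        (2 + c) * Y ^ suc d            ∎

  module _ (i : Fin 7) (β : (x o t : List Symbol) → Store 7)
    (buffer : ∀ x o t → Vec.lookup (β x o t) i ≡ x)
    (scratch : ∀ x o t → Vec.lookup (β x o t) 2F ≡ t)
    (out : ∀ a x o t → pop i ∷ push 1F a ∷ push 2F a ∷ [] ⊢ β (a ∷ x) o t ⇒ β x (a ∷ o) (a ∷ t) within 3)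
    (back : ∀ a x o t → pop 2F ∷ push i a ∷ [] ⊢ β x o (a ∷ t) ⇒ β (a ∷ x) o t within 2)
    where

    -- 11 = 6 + 5: the outward pass takes 5 steps per symbol and the return pass 4, and each has one
    -- failing test.
    emit-buffer : ∀ {d} l o → length l ≤ Y ^ d → emit i ⊢ β l o [] ⇒ β l (l ʳ++ o) [] costs 11 ·Y^ d
    emit-buffer {d} l o l≤ =
      subst₂ (λ o′ l′ → emit i ⊢ β l o [] ⇒ β l′ o′ [] costs 11 ·Y^ d)
        (sym (List.ʳ++-defn l)) (List.reverse-involutive l)
        ( linear l≤ (move-all i _ (λ x y → β x (y ++ o) y) (λ x y → buffer x (y ++ o) y)
            (λ a x y → out a x (y ++ o) y) l [])
        ⨾ linear (≤-trans (≤-reflexive (List.length-reverse l)) l≤)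
            (move-all 2F _ (λ x y → β y (List.reverse l ++ o) x) (λ x y → scratch y _ x)
            (λ a x y → back a y _ x) (List.reverse l) []))

  module _ {x o r z u e : List Symbol} where

    emit-3 : ∀ {d} → length r ≤ Y ^ d →
             emit 3F ⊢ ⟨ x , o , [] , r , z , u , e ⟩ ⇒ ⟨ x , r ʳ++ o , [] , r , z , u , e ⟩ costs 11 ·Y^ d
    emit-3 = emit-buffer 3F (λ r o t → ⟨ x , o , t , r , z , u , e ⟩) (λ _ _ _ → refl) (λ _ _ _ → refl)
      (λ _ _ _ _ → runs 3 ≤-refl λ _ → refl) (λ _ _ _ _ → runs 2 ≤-refl λ _ → refl) r o

    emit-4 : ∀ {d} → length z ≤ Y ^ d →
             emit 4F ⊢ ⟨ x , o , [] , r , z , u , e ⟩ ⇒ ⟨ x , z ʳ++ o , [] , r , z , u , e ⟩ costs 11 ·Y^ d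
    emit-4 = emit-buffer 4F (λ z o t → ⟨ x , o , t , r , z , u , e ⟩) (λ _ _ _ → refl) (λ _ _ _ → refl)
      (λ _ _ _ _ → runs 3 ≤-refl λ _ → refl) (λ _ _ _ _ → runs 2 ≤-refl λ _ → refl) z o

    emit-5 : ∀ {d} → length u ≤ Y ^ d →
             emit 5F ⊢ ⟨ x , o , [] , r , z , u , e ⟩ ⇒ ⟨ x , u ʳ++ o , [] , r , z , u , e ⟩ costs 11 ·Y^ d
    emit-5 = emit-buffer 5F (λ u o t → ⟨ x , o , t , r , z , u , e ⟩) (λ _ _ _ → refl) (λ _ _ _ → refl)
      (λ _ _ _ _ → runs 3 ≤-refl λ _ → refl) (λ _ _ _ _ → runs 2 ≤-refl λ _ → refl) u o

    emit-6 : ∀ {d} → length e ≤ Y ^ d →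
             emit 6F ⊢ ⟨ x , o , [] , r , z , u , e ⟩ ⇒ ⟨ x , e ʳ++ o , [] , r , z , u , e ⟩ costs 11 ·Y^ d
    emit-6 = emit-buffer 6F (λ e o t → ⟨ x , o , t , r , z , u , e ⟩) (λ _ _ _ → refl) (λ _ _ _ → refl)
      (λ _ _ _ _ → runs 3 ≤-refl λ _ → refl) (λ _ _ _ _ → runs 2 ≤-refl λ _ → refl) e o

-- Stack growth

-- A step pushes at most one symbol. Hence the running time bounds the length of the output, which
-- prices its final reversal.
stack-growth : ∀ {s} t (c : Configuration s) i →
               length (Vec.lookup (proj₂ (run t c)) i) ≤ t + length (Vec.lookup (proj₂ c) i)
stack-growth zero    c i = ≤-refl
stack-growth (suc t) c i = ≤-trans (stack-growth t (step c) i)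
  (≤-trans (+-monoʳ-≤ t (step-growth c)) (≤-reflexive (+-suc t _)))
  where
  lookup-%= : ∀ {s} (σ : Store s) i j {f} → (∀ x → length (f x) ≤ suc (length x)) →
              length (Vec.lookup (σ Vec.[ j ]%= f) i) ≤ suc (length (Vec.lookup σ i))
  lookup-%= (x ∷ σ) 0F          0F          f≤ = f≤ x
  lookup-%= (x ∷ σ) 0F          (Fin.suc j) f≤ = n≤1+n _
  lookup-%= (x ∷ σ) (Fin.suc i) 0F          f≤ = n≤1+n _
  lookup-%= (x ∷ σ) (Fin.suc i) (Fin.suc j) f≤ = lookup-%= σ i j f≤

  drop-growth : ∀ (x : List Symbol) → length (List.drop 1 x) ≤ suc (length x)
  drop-growth []      = z≤n
  drop-growth (a ∷ x) = ≤-trans (n≤1+n _) (n≤1+n _)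

  step-growth : ∀ c → length (Vec.lookup (proj₂ (step c)) i) ≤ suc (length (Vec.lookup (proj₂ c) i))
  step-growth ([]            , σ) = n≤1+n _
  step-growth (push j a ∷ K    , σ) = lookup-%= σ i j λ _ → ≤-refl
  step-growth (pop j ∷ K       , σ) = lookup-%= σ i j drop-growth
  step-growth (branch j P ∷ K  , σ) = n≤1+n _
  step-growth (while j b P ∷ K , σ) = n≤1+n _

output-growth : ∀ {s P t} {σ τ : Store s} → P ⊢ σ ⇒ τ within t → ∀ i →
                length (Vec.lookup τ i) ≤ t + length (Vec.lookup σ i)
output-growth {P = P} {t} {σ} {τ} (runs u u≤t r) i = begin
  length (Vec.lookup τ i)                                ≡⟨ cong (λ c → length (Vec.lookup (proj₂ c) i)) (r []) ⟨
  length (Vec.lookup (proj₂ (run u (P ++ [] , σ))) i)    ≤⟨ stack-growth u (P ++ [] , σ) i ⟩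
  u + length (Vec.lookup σ i)                            ≤⟨ +-monoˡ-≤ _ u≤t ⟩
  t + length (Vec.lookup σ i)                            ∎
  where open ≤-Reasoning

-- Strings read and written by the machine

replicate-snoc : ∀ {A : Set} n (a : A) xs → List.replicate n a ++ a ∷ xs ≡ a ∷ List.replicate n a ++ xs
replicate-snoc zero    a xs = refl
replicate-snoc (suc n) a xs = cong (a ∷_) (replicate-snoc n a xs)

replicate-ʳ++ : ∀ {A : Set} n (a : A) xs → List.replicate n a ʳ++ xs ≡ List.replicate n a ++ xs
replicate-ʳ++ zero    a xs = refl
replicate-ʳ++ (suc n) a xs = trans (replicate-ʳ++ n a (a ∷ xs)) (replicate-snoc n a xs)

foldl-ʳ++ : ∀ {A B : Set} (g : A → List B) as y →
            foldl (λ y a → g a ʳ++ y) y as ≡ List.concatMap g as ʳ++ y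
foldl-ʳ++ g []       y = refl
foldl-ʳ++ g (a ∷ as) y = trans (foldl-ʳ++ g as (g a ʳ++ y)) (sym (List.++-ʳ++ (g a)))

foldl-count : ∀ {A : Set} n (a : A) m → foldl (λ m _ → suc m) m (List.replicate n a) ≡ n + m
foldl-count zero    a m = refl
foldl-count (suc n) a m = trans (foldl-count n a (suc m)) (+-suc n m)

length-blocks : ∀ {A : Set} n (xs : List A) → length (List.concat (List.replicate n xs)) ≡ n * length xs
length-blocks zero    xs = refl
length-blocks (suc n) xs = trans (List.length-++ xs) (cong (length xs +_) (length-blocks n xs))

matrixString : List (List Symbol) → List Symbol
matrixString rs = List.concatMap (_++ [ endRow ]) rs ++ [ endMatrix ]

-- The first condition keeps the scan of a row going; the second keeps the loop over rows going when
-- it sees the first symbol of a row.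
RowSymbol : Symbol → Set
RowSymbol a = beforeRow (just a) ≡ true × beforeMatrix (just a) ≡ true

module _ (ε : List Symbol) (n : ℕ) where

  -- Here `ε` is the common tail of the strings of 0 and 1, which differ only in their first bit.
  zeros ones : List Symbol
  zeros = List.concat (List.replicate n (bit false ∷ ε))
  ones  = List.concat (List.replicate n (bit true ∷ ε))

  markerOutput : List Symbol
  markerOutput = (bit true ∷ ε) ++ ones ++ ones ++ ones ++ zeros ++ zeros ++ ones ++ [ endRow ]

  rowOutput : List Symbol → List Symbol
  rowOutput r = (bit false ∷ ε) ++ zeros ++ zeros ++ zeros ++ r ++ r ++ r ++ [ endRow ]

  matrixOutput : List (List Symbol) → List Symbol
  matrixOutput rs = (markerOutput ++ List.concatMap rowOutput rs) ++ [ endMatrix ]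

++₈-ʳ++ : ∀ {A : Set} (a b c d e f g : List A) {h o} →
          (a ++ b ++ c ++ d ++ e ++ f ++ g ++ h) ʳ++ o ≡
          h ʳ++ g ʳ++ f ʳ++ e ʳ++ d ʳ++ c ʳ++ b ʳ++ a ʳ++ o
++₈-ʳ++ a b c d e f g = trans (List.++-ʳ++ a) (trans (List.++-ʳ++ b) (trans (List.++-ʳ++ c)
  (trans (List.++-ʳ++ d) (trans (List.++-ʳ++ e) (trans (List.++-ʳ++ f) (List.++-ʳ++ g))))))

-- Running time of the machine

module Reduction (Y : ℕ) .{{_ : NonZero Y}} (ε : List Symbol) (ε≤ : suc (length ε) ≤ Y) (n : ℕ) (n≤ : n ≤ Y) where

  open Cost Y

  private
    Z U : List Symbol
    Z = zeros ε n
    U = ones ε n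

    ≤Y¹ : ∀ {l} → l ≤ Y → l ≤ Y ^ 1
    ≤Y¹ l≤ = ≤-trans l≤ (≤-reflexive (sym (*-identityʳ Y)))

    block≤ : ∀ b → length (List.concat (List.replicate n (bit b ∷ ε))) ≤ Y ^ 2
    block≤ b = ≤-trans (≤-reflexive (length-blocks n _)) (*-mono-≤ n≤ (≤Y¹ ε≤))

    element≤ : suc (length ε) ≤ Y ^ 2
    element≤ = ≤-trans (≤Y¹ ε≤) (Y^-mono {1} {2} (s≤s z≤n))

  copyUntil-costs : ∀ {b e l x o t r z u v} → length l ≤ Y → All (λ a → b (just a) ≡ true) l → b (just e) ≡ false →
    copyUntil b e ⊢ ⟨ (l ++ [ e ]) ++ x , o , t , r , z , u , v ⟩
                  ⇒ ⟨ x , (l ++ [ e ]) ʳ++ o , t , r , z , u , v ⟩ costs 7 ·Y^ 1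
  copyUntil-costs {b} {e} {l} {x} {o} {t} {r} {z} {u} {v} l≤ before end =
    subst₂ (λ x′ o′ → copyUntil b e ⊢ ⟨ x′ , o , t , r , z , u , v ⟩ ⇒ ⟨ x , o′ , t , r , z , u , v ⟩ costs 7 ·Y^ 1)
      (sym (List.++-assoc l [ e ] x)) (sym (List.++-ʳ++ l))
      ( linear (≤Y¹ l≤) (move-runs 0F b (λ a → push 1F a ∷ []) (λ x y → ⟨ x , y , t , r , z , u , v ⟩) (e ∷ x) (λ _ _ → refl) end
          (λ _ _ _ → runs 2 ≤-refl λ _ → refl) before o)
      ⨾ exactly _ 1 (runs 2 ≤-refl λ _ → refl))

  readModulus-costs : ∀ {f x o r z u} → length f ≤ Y → All (λ a → beforeElement (just a) ≡ true) f →
    List.map zeroed f ++ [ endElement ] ≡ bit false ∷ ε →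
    readModulus ⊢ ⟨ (f ++ [ endElement ]) ++ x , o , [] , r , z , u , [] ⟩
                ⇒ ⟨ x , (f ++ [ endElement ]) ʳ++ o , [] , r , z , u , bit false ∷ ε ⟩ costs 14 ·Y^ 1
  readModulus-costs {f} {x} {o} {r} {z} {u} f≤ before zero≡ =
    subst₂ (λ x′ o′ → readModulus ⊢ ⟨ x′ , o , [] , r , z , u , [] ⟩ ⇒ ⟨ x , o′ , [] , r , z , u , bit false ∷ ε ⟩ costs 14 ·Y^ 1)
      (sym (List.++-assoc f [ endElement ] x))
      (trans (cong (endElement ∷_) (sym (List.ʳ++-defn f))) (sym (List.++-ʳ++ f)))
      (subst (λ v → readModulus ⊢ ⟨ f ++ endElement ∷ x , o , [] , r , z , u , [] ⟩
                                ⇒ ⟨ x , endElement ∷ List.reverse f ++ o , [] , r , z , u , v ⟩ costs 14 ·Y^ 1)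
        reversed≡
        ( linear (≤Y¹ f≤) (move-runs 0F beforeElement (λ a → push 1F a ∷ push 2F (zeroed a) ∷ []) (λ x y → ⟨ x , y ++ o , List.map zeroed y , r , z , u , [] ⟩) (endElement ∷ x)
            (λ _ _ → refl) refl (λ _ _ _ → runs 3 ≤-refl λ _ → refl) before [])
        ⨾ exactly (pop 0F ∷ push 1F endElement ∷ push 2F endElement ∷ []) 1 (runs 3 ≤-refl λ _ → refl)
        ⨾ linear (≤Y¹ (≤-trans (≤-reflexive length≡) ε≤))
            (move-all 2F (λ a → push 6F a ∷ []) (λ t y → ⟨ x , endElement ∷ List.reverse f ++ o , t , r , z , u , y ⟩) (λ _ _ → refl)
            (λ _ _ _ → runs 2 ≤-refl λ _ → refl) (endElement ∷ List.map zeroed (List.reverse f)) [])))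
    where
    reversed≡ : (endElement ∷ List.map zeroed (List.reverse f)) ʳ++ [] ≡ bit false ∷ ε
    reversed≡ = begin
      List.map zeroed (List.reverse f) ʳ++ [ endElement ]               ≡⟨ List.ʳ++-defn (List.map zeroed (List.reverse f)) ⟩
      List.reverse (List.map zeroed (List.reverse f)) ++ [ endElement ] ≡⟨ cong (_++ [ endElement ]) (List.reverse-map zeroed (List.reverse f)) ⟨
      List.map zeroed (List.reverse (List.reverse f)) ++ [ endElement ] ≡⟨ cong (λ g → List.map zeroed g ++ [ endElement ]) (List.reverse-involutive f) ⟩
      List.map zeroed f ++ [ endElement ]                               ≡⟨ zero≡ ⟩
      bit false ∷ ε                                                     ∎
      where open ≡-Reasoning
    length≡ : length (endElement ∷ List.map zeroed (List.reverse f)) ≡ suc (length ε)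
    length≡ = trans (sym (List.length-reverse (endElement ∷ List.map zeroed (List.reverse f)))) (cong length reversed≡)

  readBlocklength-costs : ∀ {x o} →
    readBlocklength ⊢ ⟨ unary n ++ x , o , [] , [] , [] , [] , bit false ∷ ε ⟩
                    ⇒ ⟨ x , unary (suc (n * 6)) ʳ++ o , [] , [] , Z , U , bit false ∷ ε ⟩ costs 26 ·Y^ 2
  readBlocklength-costs {x} {o} =
    subst₂ (λ x′ o′ → readBlocklength ⊢ ⟨ x′ , o , [] , [] , [] , [] , bit false ∷ ε ⟩
                                      ⇒ ⟨ x , o′ , [] , [] , Z , U , bit false ∷ ε ⟩ costs 26 ·Y^ 2)
      (sym (List.++-assoc (List.replicate n (bit true)) [ endElement ] x)) (sym output≡)
      ( exactly [ push 1F (bit true) ] 2 (runs 1 ≤-refl λ _ → refl)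
      ⨾ subst (λ m → [ while 0F beforeElement readBit ] ⊢ blocks (List.replicate n (bit true)) 0 ⇒ blocks [] m costs 23 ·Y^ 2)
          (trans (foldl-count n (bit true) 0) (+-identityʳ n))
          (while-costs (_≡ bit true) blocks (λ m _ → suc m) (λ { refl _ _ → refl }) (λ _ → refl)
            (λ { refl → block }) (≤-trans (≤-reflexive (List.length-replicate n)) n≤) (All.replicate⁺ n refl) 0)
      ⨾ exactly _ 2 (runs 2 ≤-refl λ _ → refl))
    where
    blocks : List Symbol → ℕ → Store 7
    blocks as m = ⟨ as ++ endElement ∷ x , List.replicate (m * 6) (bit true) ++ bit true ∷ o , [] , []
                  , zeros ε m , ones ε m , bit false ∷ ε ⟩

    block : ∀ as m → readBit ⊢ blocks (bit true ∷ as) m ⇒ blocks as (suc m) costs 21 ·Y^ 1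
    block as m =
        exactly (pop 0F ∷ sixBits) 1 (runs 7 ≤-refl λ _ → refl)
      ⨾ linear {t = 4} (≤Y¹ ε≤) (move-all 6F (λ a → push 2F a ∷ []) (λ v y → ⟨ i , o′ , y , [] , z , u , v ⟩) (λ _ _ → refl)
          (λ _ _ _ → runs 2 ≤-refl λ _ → refl) (bit false ∷ ε) [])
      ⨾ subst (λ y → move 2F is-just (λ a → push 6F a ∷ push 4F a ∷ push 5F a ∷ []) ⊢ ⟨ i , o′ , List.reverse (bit false ∷ ε) , [] , z , u , [] ⟩
                       ⇒ ⟨ i , o′ , [] , [] , y ++ z , y ++ u , y ⟩ costs 7 ·Y^ 1)
          (List.reverse-involutive (bit false ∷ ε))
          (linear (≤Y¹ (≤-trans (≤-reflexive (List.length-reverse (bit false ∷ ε))) ε≤))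
            (move-all 2F _ (λ t y → ⟨ i , o′ , t , [] , y ++ z , y ++ u , y ⟩) (λ _ _ → refl)
            (λ _ _ _ → runs 4 ≤-refl λ _ → refl) (List.reverse (bit false ∷ ε)) []))
      ⨾ exactly _ 1 (runs 2 ≤-refl λ _ → refl)
      where
      i o′ z u : List Symbol
      i  = as ++ endElement ∷ x
      o′ = List.replicate (suc m * 6) (bit true) ++ bit true ∷ o
      z  = zeros ε m
      u  = ones ε m

    output≡ : unary (suc (n * 6)) ʳ++ o ≡ endElement ∷ List.replicate (n * 6) (bit true) ++ bit true ∷ o
    output≡ = trans (List.++-ʳ++ (List.replicate (n * 6) (bit true)))
      (cong (endElement ∷_) (replicate-ʳ++ (n * 6) (bit true) (bit true ∷ o)))

  markerRow-costs : ∀ {x o} →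
    markerRow ⊢ ⟨ x , o , [] , [] , Z , U , bit false ∷ ε ⟩
              ⇒ ⟨ x , markerOutput ε n ʳ++ o , [] , [] , Z , U , bit false ∷ ε ⟩ costs 82 ·Y^ 2
  markerRow-costs {x} {o} =
    subst (λ o′ → markerRow ⊢ ⟨ x , o , [] , [] , Z , U , bit false ∷ ε ⟩
                            ⇒ ⟨ x , o′ , [] , [] , Z , U , bit false ∷ ε ⟩ costs 82 ·Y^ 2)
      (sym (++₈-ʳ++ (bit true ∷ ε) U U U Z Z U))
      ( exactly (pop 6F ∷ push 6F (bit true) ∷ []) 2 (runs 2 ≤-refl λ _ → refl)
      ⨾ emit-6 element≤
      ⨾ exactly (pop 6F ∷ push 6F (bit false) ∷ []) 2 (runs 2 ≤-refl λ _ → refl)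
      ⨾ emit-5 (block≤ true) ⨾ emit-5 (block≤ true) ⨾ emit-5 (block≤ true)
      ⨾ emit-4 (block≤ false) ⨾ emit-4 (block≤ false) ⨾ emit-5 (block≤ true)
      ⨾ exactly _ 2 (runs 1 ≤-refl λ _ → refl))

  transformRow-costs : ∀ {l x o} → length l ≤ Y ^ 2 → All (λ a → beforeRow (just a) ≡ true) l →
    transformRow ⊢ ⟨ l ++ endRow ∷ x , o , [] , [] , Z , U , bit false ∷ ε ⟩
                 ⇒ ⟨ x , rowOutput ε n l ʳ++ o , [] , [] , Z , U , bit false ∷ ε ⟩ costs 93 ·Y^ 2
  transformRow-costs {l} {x} {o} l≤ before =
    subst (λ o′ → transformRow ⊢ ⟨ l ++ endRow ∷ x , o , [] , [] , Z , U , bit false ∷ ε ⟩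
                               ⇒ ⟨ x , o′ , [] , [] , Z , U , bit false ∷ ε ⟩ costs 93 ·Y^ 2)
      (sym (++₈-ʳ++ (bit false ∷ ε) Z Z Z l l l))
      ( linear l≤ (move-runs 0F beforeRow (λ a → push 2F a ∷ []) (λ x t → ⟨ x , o , t , [] , Z , U , bit false ∷ ε ⟩) (endRow ∷ x) (λ _ _ → refl) refl
          (λ _ _ _ → runs 2 ≤-refl λ _ → refl) before [])
      ⨾ exactly [ pop 0F ] 2 (runs 1 ≤-refl λ _ → refl)
      ⨾ subst (λ r → move 2F is-just (λ a → push 3F a ∷ []) ⊢ ⟨ x , o , List.reverse l , [] , Z , U , bit false ∷ ε ⟩
                       ⇒ ⟨ x , o , [] , r , Z , U , bit false ∷ ε ⟩ costs 5 ·Y^ 2)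
          (List.reverse-involutive l)
          (linear (≤-trans (≤-reflexive (List.length-reverse l)) l≤)
            (move-all 2F _ (λ t r → ⟨ x , o , t , r , Z , U , bit false ∷ ε ⟩) (λ _ _ → refl)
            (λ _ _ _ → runs 2 ≤-refl λ _ → refl) (List.reverse l) []))
      ⨾ emit-6 element≤
      ⨾ emit-4 (block≤ false) ⨾ emit-4 (block≤ false) ⨾ emit-4 (block≤ false)
      ⨾ emit-3 l≤ ⨾ emit-3 l≤ ⨾ emit-3 l≤
      ⨾ exactly [ push 1F endRow ] 2 (runs 1 ≤-refl λ _ → refl)
      ⨾ linear l≤ (move-all 3F (λ _ → []) (λ r _ → ⟨ x , o′ , [] , r , Z , U , bit false ∷ ε ⟩) (λ _ _ → refl)
          (λ _ _ _ → runs 1 ≤-refl λ _ → refl) l []))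
    where
    o′ : List Symbol
    o′ = endRow ∷ l ʳ++ l ʳ++ l ʳ++ Z ʳ++ Z ʳ++ Z ʳ++ (bit false ∷ ε) ʳ++ o

  -- Each of at most `Y` rows has at most `Y ^ 2` symbols, which is the source of the degree 3.
  transformMatrix-costs : ∀ {rs x o} → length rs ≤ Y → All (λ r → length r ≤ Y ^ 2 × All RowSymbol r) rs →
    transformMatrix ⊢ ⟨ matrixString rs ++ x , o , [] , [] , Z , U , bit false ∷ ε ⟩
                    ⇒ ⟨ x , matrixOutput ε n rs ʳ++ o , [] , [] , Z , U , bit false ∷ ε ⟩ costs 179 ·Y^ 3
  transformMatrix-costs {rs} {x} {o} rs≤ valid =
    subst₂ (λ x′ o′ → transformMatrix ⊢ ⟨ x′ , o , [] , [] , Z , U , bit false ∷ ε ⟩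
                                      ⇒ ⟨ x , o′ , [] , [] , Z , U , bit false ∷ ε ⟩ costs 179 ·Y^ 3)
      (sym (List.++-assoc (List.concatMap (_++ [ endRow ]) rs) [ endMatrix ] x))
      (sym (trans (List.++-ʳ++ (markerOutput ε n ++ List.concatMap (rowOutput ε n) rs))
        (cong (endMatrix ∷_) (List.++-ʳ++ (markerOutput ε n)))))
      ( raise (s≤s (s≤s z≤n)) markerRow-costs
      ⨾ subst (λ o′ → [ while 0F beforeMatrix transformRow ] ⊢ rows rs (markerOutput ε n ʳ++ o) ⇒ rows [] o′ costs 95 ·Y^ 3)
          (foldl-ʳ++ (rowOutput ε n) rs _)
          (while-costs (λ r → length r ≤ Y ^ 2 × All RowSymbol r) rows (λ y r → rowOutput ε n r ʳ++ y)
            (λ {r} v as y → continue r (proj₂ v)) (λ _ → refl)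
            (λ {r} (r≤ , v) as y → subst (λ x′ → transformRow ⊢ ⟨ x′ , y , [] , [] , Z , U , bit false ∷ ε ⟩ ⇒ rows as _ costs 93 ·Y^ 2)
               (sym (row≡ r as)) (transformRow-costs r≤ (All.map proj₁ v)))
            rs≤ valid _)
      ⨾ exactly _ 3 (runs 2 ≤-refl λ _ → refl))
    where
    rows : List (List Symbol) → List Symbol → Store 7
    rows rs o = ⟨ List.concatMap (_++ [ endRow ]) rs ++ endMatrix ∷ x , o , [] , [] , Z , U , bit false ∷ ε ⟩

    row≡ : ∀ r as → List.concatMap (_++ [ endRow ]) (r ∷ as) ++ endMatrix ∷ x ≡
                    r ++ endRow ∷ List.concatMap (_++ [ endRow ]) as ++ endMatrix ∷ x
    row≡ r as = trans (List.++-assoc (r ++ [ endRow ]) _ _) (List.++-assoc r [ endRow ] _)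

    continue : ∀ r {y y′} → All RowSymbol r → beforeMatrix (List.head (((r ++ [ endRow ]) ++ y) ++ y′)) ≡ true
    -- An empty row string, as for n = 0, shows `endRow`, which does not stop the loop over rows.
    continue []      []            = refl
    continue (a ∷ r) ((_ , v) ∷ _) = v

  -- 2066 = 413 + (4 · 413 + 1): the forward pass costs 413 and so writes at most 413 · `Y ^ 3`
  -- symbols, each of which is moved back in 4 steps, with one failing test at the end.
  reduction-costs : ∀ {ν f k Gs Hs} →
    length ν ≤ Y → All (λ a → beforeCoefficient (just a) ≡ true) ν →
    length f ≤ Y → All (λ a → beforeElement (just a) ≡ true) f →
    List.map zeroed f ++ [ endElement ] ≡ bit false ∷ ε → k ≤ Y →
    length Gs ≤ Y → All (λ r → length r ≤ Y ^ 2 × All RowSymbol r) Gs →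
    length Hs ≤ Y → All (λ r → length r ≤ Y ^ 2 × All RowSymbol r) Hs →
    reduction ⊢ ⟨ (ν ++ [ endCoefficient ]) ++ (f ++ [ endElement ]) ++ unary k ++ unary n ++
                  matrixString Gs ++ matrixString Hs , [] , [] , [] , [] , [] , [] ⟩
              ⇒ ⟨ (ν ++ [ endCoefficient ]) ++ (f ++ [ endElement ]) ++ unary (suc k) ++ unary (suc (n * 6)) ++
                  matrixOutput ε n Gs ++ matrixOutput ε n Hs , [] , [] , [] , Z , U , bit false ∷ ε ⟩
              costs 2066 ·Y^ 3
  reduction-costs {ν} {f} {k} {Gs} {Hs} ν≤ νv f≤ fv zero≡ k≤ Gs≤ Gv Hs≤ Hv =
    subst (λ y → reduction ⊢ ⟨ input , [] , [] , [] , [] , [] , [] ⟩ ⇒ ⟨ y , [] , [] , [] , Z , U , bit false ∷ ε ⟩ costs 2066 ·Y^ 3)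
      (List.reverse-involutive output)
      ( forward
      ⨾ costs (weaken final≤ (move-all 1F (λ a → push 0F a ∷ []) (λ o x → ⟨ x , o , [] , [] , Z , U , bit false ∷ ε ⟩)
          (λ _ _ → refl) (λ _ _ _ → runs 2 ≤-refl λ _ → refl) (List.reverse output) [])))
    where
    N F K L G′ H′ input output : List Symbol
    N = ν ++ [ endCoefficient ]
    F = f ++ [ endElement ]
    K = unary (suc k)
    L = unary (suc (n * 6))
    G′ = matrixOutput ε n Gs
    H′ = matrixOutput ε n Hs
    input = N ++ F ++ unary k ++ unary n ++ matrixString Gs ++ matrixString Hs
    output = N ++ F ++ K ++ L ++ G′ ++ H′

    reverse-output : H′ ʳ++ G′ ʳ++ L ʳ++ K ʳ++ F ʳ++ N ʳ++ [] ≡ List.reverse output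
    reverse-output = sym (trans (List.++-ʳ++ N) (trans (List.++-ʳ++ F) (trans (List.++-ʳ++ K)
      (trans (List.++-ʳ++ L) (List.++-ʳ++ G′)))))

    forward : transformAll ⊢ ⟨ input , [] , [] , [] , [] , [] , [] ⟩
                           ⇒ ⟨ [] , List.reverse output , [] , [] , Z , U , bit false ∷ ε ⟩ costs 413 ·Y^ 3
    forward = subst₂ (λ x o → transformAll ⊢ ⟨ x , [] , [] , [] , [] , [] , [] ⟩
                                           ⇒ ⟨ [] , o , [] , [] , Z , U , bit false ∷ ε ⟩ costs 413 ·Y^ 3)
      (cong (λ x → N ++ F ++ unary k ++ unary n ++ matrixString Gs ++ x) (List.++-identityʳ (matrixString Hs)))
      reverse-output
      ( raise (s≤s z≤n) (copyUntil-costs ν≤ νv refl)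
      ⨾ raise (s≤s z≤n) (readModulus-costs f≤ fv zero≡)
      ⨾ (exactly [ push 1F (bit true) ] 3 (runs 1 ≤-refl λ _ → refl)
         ⨾ raise (s≤s z≤n) (copyUntil-costs (≤-trans (≤-reflexive (List.length-replicate k)) k≤) (All.replicate⁺ k refl) refl))
      ⨾ raise (s≤s (s≤s z≤n)) readBlocklength-costs
      ⨾ transformMatrix-costs Gs≤ Gv
      ⨾ transformMatrix-costs Hs≤ Hv)

    final≤ : length (List.reverse output) * 4 + 1 ≤ 1653 * Y ^ 3
    final≤ = begin
      length (List.reverse output) * 4 + 1    ≤⟨ +-mono-≤ (*-monoˡ-≤ 4 (output-growth (within forward) 1F)) (Y^-mono {0} {3} z≤n) ⟩
      (413 * Y ^ 3 + 0) * 4 + Y ^ 3           ≡⟨ cong (λ l → l * 4 + Y ^ 3) (+-identityʳ (413 * Y ^ 3)) ⟩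
      413 * Y ^ 3 * 4 + Y ^ 3                 ≡⟨ cong (_+ Y ^ 3) (*-comm (413 * Y ^ 3) 4) ⟩
      4 * (413 * Y ^ 3) + Y ^ 3               ≡⟨ cong (_+ Y ^ 3) (*-assoc 4 413 (Y ^ 3)) ⟨
      1652 * Y ^ 3 + Y ^ 3                    ≡⟨ +-comm (1652 * Y ^ 3) (Y ^ 3) ⟩
      1653 * Y ^ 3                            ∎
      where open ≤-Reasoning

-- Strings of numbers, field elements and matrices

-- In the form `n * 6`, a further digit of `n` unfolds to six more symbols by computation, as the
-- loop over the digits requires.
reducedLength≡ : ∀ n → reducedLength n ≡ suc (n * 6)
reducedLength≡ = solve 1 (λ n → con 1 :+ (n :+ (n :+ (n :+ (n :+ (n :+ n))))) := con 1 :+ n :* con 6) refl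
  where open +-*-Solver

concat-tabulate-++ : ∀ {A B : Set} {m n} (f : A → List B) (xs : Vector A m) (ys : Vector A n) →
  List.concat (List.tabulate (f ∘ (xs Vector.++ ys))) ≡
  List.concat (List.tabulate (f ∘ xs)) ++ List.concat (List.tabulate (f ∘ ys))
concat-tabulate-++ {m = zero}  f xs ys = refl
concat-tabulate-++ {m = suc m} f xs ys = begin
  f (xs Fin.zero) ++ List.concat (List.tabulate (f ∘ (xs Vector.++ ys) ∘ Fin.suc))
    ≡⟨ cong (λ l → f (xs Fin.zero) ++ List.concat l) (List.tabulate-cong λ i → cong f (++-suc xs ys i)) ⟩
  f (xs Fin.zero) ++ List.concat (List.tabulate (f ∘ (xs ∘ Fin.suc Vector.++ ys)))
    ≡⟨ cong (f (xs Fin.zero) ++_) (concat-tabulate-++ f (xs ∘ Fin.suc) ys) ⟩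
  f (xs Fin.zero) ++ List.concat (List.tabulate (f ∘ xs ∘ Fin.suc)) ++ List.concat (List.tabulate (f ∘ ys))
    ≡⟨ List.++-assoc (f (xs Fin.zero)) _ _ ⟨
  (f (xs Fin.zero) ++ List.concat (List.tabulate (f ∘ xs ∘ Fin.suc))) ++ List.concat (List.tabulate (f ∘ ys)) ∎
  where open ≡-Reasoning

concat-tabulate-const : ∀ {A : Set} n (l : List A) →
  List.concat (List.tabulate {n = n} (const l)) ≡ List.concat (List.replicate n l)
concat-tabulate-const zero    l = refl
concat-tabulate-const (suc n) l = cong (l ++_) (concat-tabulate-const n l)

concat-tabulate-columns : ∀ {A : Set} n (f : Column n → List A) →
  let t = List.concat (List.replicate n (f mark))
      x = List.concat (List.tabulate (f ∘ plain))
  in List.concat (List.tabulate (f ∘ columns n)) ≡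
     f mark ++ t ++ t ++ t ++ x ++ x ++ List.concat (List.tabulate (f ∘ link))
concat-tabulate-columns n f = cong (f mark ++_)
  (trans (concat-tabulate-++ f marks _) (cong₂ _++_ (concat-tabulate-const n _)
  (trans (concat-tabulate-++ f marks _) (cong₂ _++_ (concat-tabulate-const n _)
  (trans (concat-tabulate-++ f marks _) (cong₂ _++_ (concat-tabulate-const n _)
  (trans (concat-tabulate-++ f plain _) (cong (List.concat (List.tabulate (f ∘ plain)) ++_)
  (concat-tabulate-++ f plain link)))))))))

++₇-assoc : ∀ {A : Set} (a b c d e f g : List A) {h} →
  (a ++ b ++ c ++ d ++ e ++ f ++ g) ++ h ≡ a ++ b ++ c ++ d ++ e ++ f ++ g ++ h
++₇-assoc a b c d e f g = trans (List.++-assoc a _ _) (cong (a ++_) (trans (List.++-assoc b _ _) (cong (b ++_)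
  (trans (List.++-assoc c _ _) (cong (c ++_) (trans (List.++-assoc d _ _) (cong (d ++_)
  (trans (List.++-assoc e _ _) (cong (e ++_) (List.++-assoc f g _))))))))))

-- Strong induction: halving `n` lowers the logarithm by one, and twice `⌊ n /2⌋` is at most `n`.
2^⌊log₂n⌋≤n : ∀ n .{{_ : NonZero n}} → 2 ^ ⌊log₂ n ⌋ ≤ n
2^⌊log₂n⌋≤n = <-rec (λ n → .{{_ : NonZero n}} → 2 ^ ⌊log₂ n ⌋ ≤ n) bound
  where
  open ≤-Reasoning
  bound : ∀ n → (∀ {m} → m < n → .{{_ : NonZero m}} → 2 ^ ⌊log₂ m ⌋ ≤ m) → .{{_ : NonZero n}} → 2 ^ ⌊log₂ n ⌋ ≤ n
  bound 1          rec = s≤s z≤n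
  bound n@(2+ n-2) rec = begin
    2 ^ ⌊log₂ n ⌋                     ≡⟨ cong (2 ^_) (suc-pred ⌊log₂ n ⌋ {{>-nonZero (⌊log₂⌋-mono-≤ {2} {n} (s≤s (s≤s z≤n)))}}) ⟨
    2 * 2 ^ pred ⌊log₂ n ⌋            ≡⟨ cong (λ l → 2 * 2 ^ l) (trans (sym (pred[m∸n]≡m∸[1+n] ⌊log₂ n ⌋ 0)) (sym (⌊log₂⌊n/2⌋⌋≡⌊log₂n⌋∸1 n))) ⟩
    2 * 2 ^ ⌊log₂ ⌊ n /2⌋ ⌋           ≤⟨ *-monoʳ-≤ 2 (rec (⌊n/2⌋<n (suc n-2))) ⟩
    ⌊ n /2⌋ + (⌊ n /2⌋ + 0)           ≡⟨ cong (⌊ n /2⌋ +_) (+-identityʳ ⌊ n /2⌋) ⟩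
    ⌊ n /2⌋ + ⌊ n /2⌋                 ≤⟨ +-monoʳ-≤ ⌊ n /2⌋ (⌊n/2⌋≤⌈n/2⌉ n) ⟩
    ⌊ n /2⌋ + ⌈ n /2⌉                 ≡⟨ ⌊n/2⌋+⌈n/2⌉≡n n ⟩
    n                                 ∎

binary-length : ∀ w a → length (binary w a) ≡ w
binary-length zero    a = refl
binary-length (suc w) a = cong suc (binary-length w ⌊ a /2⌋)

zeroed-binary : ∀ w a → List.map zeroed (binary w a) ≡ binary w 0
zeroed-binary zero    a = refl
zeroed-binary (suc w) a = cong (bit false ∷_) (zeroed-binary w ⌊ a /2⌋)

binary-All : ∀ {P : Symbol → Set} → (∀ b → P (bit b)) → ∀ w a → All P (binary w a)
binary-All P zero    a = []
binary-All P (suc w) a = P _ ∷ binary-All P w ⌊ a /2⌋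

module Numerals (p : ℕ) where

  -- These repeat the local functions of `encode`, so that the strings below agree with `encode I`
  -- by unfolding.
  number : ℕ → List Symbol
  number a = binary (suc ⌊log₂ p ⌋) a ++ [ endCoefficient ]

  digits : ∀ {m} → Vec (Fin p) m → List Symbol
  digits v = List.concatMap (λ a → number (toℕ a)) (Vec.toList v)

  element : ∀ {m} → Vec (Fin p) m → List Symbol
  element v = digits v ++ [ endElement ]

  number-length : ∀ a → length (number a) ≡ 2 + ⌊log₂ p ⌋
  number-length a = begin
    length (number a)                        ≡⟨ List.length-++ (binary (suc ⌊log₂ p ⌋) a) ⟩
    length (binary (suc ⌊log₂ p ⌋) a) + 1    ≡⟨ cong (_+ 1) (binary-length (suc ⌊log₂ p ⌋) a) ⟩
    suc ⌊log₂ p ⌋ + 1                        ≡⟨ +-comm _ 1 ⟩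
    2 + ⌊log₂ p ⌋                            ∎
    where open ≡-Reasoning

  digits-length : ∀ {m} (v : Vec (Fin p) m) → length (digits v) ≡ m * (2 + ⌊log₂ p ⌋)
  digits-length []      = refl
  digits-length (a ∷ v) = trans (List.length-++ (number (toℕ a))) (cong₂ _+_ (number-length (toℕ a)) (digits-length v))

  element-length : ∀ {m} (v : Vec (Fin p) m) → length (element v) ≡ suc (m * (2 + ⌊log₂ p ⌋))
  element-length v = trans (List.length-++ (digits v)) (trans (+-comm _ 1) (cong suc (digits-length v)))

  digits-All : ∀ {P : Symbol → Set} → (∀ b → P (bit b)) → P endCoefficient → ∀ {m} (v : Vec (Fin p) m) → All P (digits v)
  digits-All Pb Pe []      = []
  digits-All Pb Pe (a ∷ v) = All.++⁺ {xs = number (toℕ a)} (All.++⁺ (binary-All Pb (suc ⌊log₂ p ⌋) (toℕ a)) (Pe ∷ [])) (digits-All Pb Pe v)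

  element-RowSymbol : ∀ {m} (v : Vec (Fin p) m) → All RowSymbol (element v)
  element-RowSymbol v = All.++⁺ (digits-All (λ _ → refl , refl) (refl , refl) v) ((refl , refl) ∷ [])

  module _ {z : Fin p} (z≡0 : toℕ z ≡ 0) where

    zeroed-digits : ∀ {m} (v : Vec (Fin p) m) → List.map zeroed (digits v) ≡ digits (Vec.replicate m z)
    zeroed-digits []      = refl
    zeroed-digits (a ∷ v) = trans (List.map-++ zeroed (number (toℕ a)) (digits v)) (cong₂ _++_ zeroed-number (zeroed-digits v))
      where
      zeroed-number : List.map zeroed (number (toℕ a)) ≡ number (toℕ z)
      zeroed-number = trans (List.map-++ zeroed (binary (suc ⌊log₂ p ⌋) (toℕ a)) _)
        (cong (_++ [ endCoefficient ]) (trans (zeroed-binary (suc ⌊log₂ p ⌋) (toℕ a)) (cong (binary _) (sym z≡0))))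

    -- With `o` the residue 1, these are the coordinates of the field element 1, the zeroth power of
    -- `α`.
    unitVector : Fin p → ∀ m → Vec (Fin p) m
    unitVector o zero    = []
    unitVector o (suc m) = o ∷ Vec.replicate m z

    zeroTail : ℕ → List Symbol
    zeroTail m = List.drop 1 (element (Vec.replicate m z))

    element-zero : ∀ m .{{_ : NonZero m}} → element (Vec.replicate m z) ≡ bit false ∷ zeroTail m
    element-zero (suc m) rewrite z≡0 = refl

    element-unit : ∀ {o} → toℕ o ≡ 1 → ∀ m .{{_ : NonZero m}} → element (unitVector o m) ≡ bit true ∷ zeroTail m
    element-unit o≡1 (suc m) rewrite z≡0 | o≡1 = refl

-- Strings of field elements and reduced matrices

module FieldStrings (Φ : FiniteField) where

  open FiniteField Φ using
    (F; p; m; prime; α; modulus; coordinates; coordinates-cong; evaluate-coordinates; coordinates-evaluate)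
  module 𝔽 = Field F
  open 𝔽 using (Carrier; _≈_; 0#; 1#; semiring)
  open Numerals p public
  open ReducedMatrix F
  open Sum semiring using (sum; sum-cong-≋; sum-replicate-zero)
  open Mult semiring using () renaming (_×_ to _·_)
  open Exp semiring using () renaming (_^_ to _^ᶠ_)

  1<p : 1 < p
  1<p = nonTrivial⇒n>1 p {{prime⇒nonTrivial prime}}

  0ₚ 1ₚ : Fin p
  0ₚ = Fin.fromℕ< (<-trans 0<1+n 1<p)
  1ₚ = Fin.fromℕ< 1<p

  0ₚ≡0 : toℕ 0ₚ ≡ 0
  0ₚ≡0 = Fin.toℕ-fromℕ< _

  1ₚ≡1 : toℕ 1ₚ ≡ 1
  1ₚ≡1 = Fin.toℕ-fromℕ< 1<p

  private
    value : ∀ {m} → Vec (Fin p) m → Carrier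
    value v = sum (λ i → toℕ (Vec.lookup v i) · (α ^ᶠ toℕ i))

    zero-sum : ∀ {m} (e : Fin m → ℕ) → sum (λ i → toℕ (Vec.lookup (Vec.replicate m 0ₚ) i) · (α ^ᶠ e i)) ≈ 0#
    zero-sum {m} e = 𝔽.trans (sum-cong-≋ λ i → 𝔽.reflexive (cong (_· (α ^ᶠ e i))
      (trans (cong toℕ (Vec.lookup-replicate i 0ₚ)) 0ₚ≡0))) (sum-replicate-zero m)

    value-unit : ∀ m .{{_ : NonZero m}} → value (unitVector 0ₚ≡0 1ₚ m) ≈ 1#
    value-unit (suc m) = 𝔽.trans (𝔽.+-cong (𝔽.trans (𝔽.reflexive (cong (_· 1#) 1ₚ≡1)) (𝔽.+-identityʳ 1#)) (zero-sum {m} (suc ∘ toℕ)))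
      (𝔽.+-identityʳ 1#)

    value-empty : ∀ {m} → m ≡ 0 → (v : Vec (Fin p) m) → value v ≈ 0#
    value-empty refl [] = 𝔽.refl

  instance
    -- For `m ≡ 0` every element would be an empty sum, so 1 would equal 0.
    m≢0 : NonZero m
    m≢0 = ≢-nonZero λ m≡0 → 𝔽.1≉0 (𝔽.trans (𝔽.sym (evaluate-coordinates 1#)) (value-empty m≡0 (coordinates 1#)))

  string : Carrier → List Symbol
  string x = element (coordinates x)

  string-cong : ∀ {x y} → x ≈ y → string x ≡ string y
  string-cong x≈y = cong element (coordinates-cong x≈y)

  ε : List Symbol
  ε = zeroTail 0ₚ≡0 m

  -- `coordinates` is known only as the inverse of `evaluate`, so the coordinates of 0 are found by
  -- evaluating the zero vector; `string-1` proceeds in the same way.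
  string-0 : string 0# ≡ bit false ∷ ε
  string-0 = trans (cong element (trans (coordinates-cong (𝔽.sym (zero-sum {m} toℕ))) (coordinates-evaluate (Vec.replicate m 0ₚ))))
    (element-zero 0ₚ≡0 m)

  string-1 : string 1# ≡ bit true ∷ ε
  string-1 = trans (cong element (trans (coordinates-cong (𝔽.sym (value-unit m))) (coordinates-evaluate (unitVector 0ₚ≡0 1ₚ m))))
    (element-unit 0ₚ≡0 1ₚ≡1 m)

  zeroed-modulus : List.map zeroed (digits modulus) ++ [ endElement ] ≡ bit false ∷ ε
  zeroed-modulus = trans (cong (_++ [ endElement ]) (zeroed-digits 0ₚ≡0 modulus)) (element-zero 0ₚ≡0 m)

  rowString : ∀ {n} → Vector Carrier n → List Symbol
  rowString v = List.concat (List.tabulate (string ∘ v))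

  matrixString′ : ∀ {k n} → Vector (Vector Carrier n) k → List Symbol
  matrixString′ A = List.concat (List.tabulate (λ i → rowString (A i) ++ [ endRow ])) ++ [ endMatrix ]

  rows : ∀ {k n} → Vector (Vector Carrier n) k → List (List Symbol)
  rows A = List.tabulate (rowString ∘ A)

  matrixString-rows : ∀ {k n} (A : Vector (Vector Carrier n) k) → matrixString′ A ≡ matrixString (rows A)
  matrixString-rows A = cong (λ l → List.concat l ++ [ endMatrix ]) (sym (List.map-tabulate (rowString ∘ A) (_++ [ endRow ])))

  private
    markerString : ∀ n → rowString (entry 1# (const 0#) ∘ columns n) ++ [ endRow ] ≡ markerOutput ε n
    markerString n = begin
      rowString (entry 1# (const 0#) ∘ columns n) ++ [ endRow ]
        ≡⟨ cong (_++ [ endRow ]) (concat-tabulate-columns n (string ∘ entry 1# (const 0#))) ⟩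
      (string 1# ++ U ++ U ++ U ++ Z ++ Z ++ L) ++ [ endRow ]
        ≡⟨ cong (_++ [ endRow ]) (cong₂ _++_ string-1 (cong₂ _++_ U≡ (cong₂ _++_ U≡ (cong₂ _++_ U≡
             (cong₂ _++_ Z≡ (cong₂ _++_ Z≡ L≡)))))) ⟩
      ((bit true ∷ ε) ++ ones ε n ++ ones ε n ++ ones ε n ++ zeros ε n ++ zeros ε n ++ ones ε n) ++ [ endRow ]
        ≡⟨ ++₇-assoc (bit true ∷ ε) (ones ε n) (ones ε n) (ones ε n) (zeros ε n) (zeros ε n) (ones ε n) ⟩
      markerOutput ε n ∎
      where
      open ≡-Reasoning
      U Z L : List Symbol
      U = List.concat (List.replicate n (string 1#))
      Z = List.concat (List.tabulate {n = n} (const (string 0#)))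
      L = List.concat (List.tabulate {n = n} (const (string (0# 𝔽.+ 1#))))
      U≡ : U ≡ ones ε n
      U≡ = cong (List.concat ∘ List.replicate n) string-1
      Z≡ : Z ≡ zeros ε n
      Z≡ = trans (concat-tabulate-const n _) (cong (List.concat ∘ List.replicate n) string-0)
      L≡ : L ≡ ones ε n
      L≡ = trans (concat-tabulate-const n _) (cong (List.concat ∘ List.replicate n) (trans (string-cong (𝔽.+-identityˡ 1#)) string-1))

    dataString : ∀ {n} (x : Vector Carrier n) → rowString (entry 0# x ∘ columns n) ++ [ endRow ] ≡ rowOutput ε n (rowString x)
    dataString {n} x = begin
      rowString (entry 0# x ∘ columns n) ++ [ endRow ]
        ≡⟨ cong (_++ [ endRow ]) (concat-tabulate-columns n (string ∘ entry 0# x)) ⟩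
      (string 0# ++ Z ++ Z ++ Z ++ X ++ X ++ L) ++ [ endRow ]
        ≡⟨ cong (_++ [ endRow ]) (cong₂ _++_ string-0 (cong₂ _++_ Z≡ (cong₂ _++_ Z≡ (cong₂ _++_ Z≡
             (cong (λ L → X ++ X ++ L) L≡))))) ⟩
      ((bit false ∷ ε) ++ zeros ε n ++ zeros ε n ++ zeros ε n ++ X ++ X ++ X) ++ [ endRow ]
        ≡⟨ ++₇-assoc (bit false ∷ ε) (zeros ε n) (zeros ε n) (zeros ε n) X X X ⟩
      rowOutput ε n X ∎
      where
      open ≡-Reasoning
      X Z L : List Symbol
      X = rowString x
      Z = List.concat (List.replicate n (string 0#))
      L = rowString (λ i → x i 𝔽.+ 0#)
      Z≡ : Z ≡ zeros ε n
      Z≡ = cong (List.concat ∘ List.replicate n) string-0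
      L≡ : L ≡ X
      -- `x i + 0` equals `x i` only up to `≈`, but coordinates respect `≈`, so the strings are
      -- identical.
      L≡ = cong List.concat (List.tabulate-cong λ i → string-cong (𝔽.+-identityʳ (x i)))

  matrixString-reduced : ∀ {k n} (A : Vector (Vector Carrier n) k) → matrixString′ (reduced A) ≡ matrixOutput ε n (rows A)
  matrixString-reduced {n = n} A = cong (_++ [ endMatrix ]) (cong₂ _++_ (markerString n)
    (cong List.concat (trans (List.tabulate-cong (dataString ∘ A)) (sym (List.map-tabulate (rowString ∘ A) (rowOutput ε n))))))

  rowString-RowSymbol : ∀ {n} (v : Vector Carrier n) → All RowSymbol (rowString v)
  rowString-RowSymbol v = All.concat⁺ (All.tabulate⁺ λ j → element-RowSymbol (coordinates (v j)))

  rowString-length : ∀ {n} (v : Vector Carrier n) → length (rowString v) ≡ n * suc (m * (2 + ⌊log₂ p ⌋))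
  rowString-length {zero}  v = refl
  rowString-length {suc n} v = trans (List.length-++ (string (v Fin.zero)))
    (cong₂ _+_ (element-length (coordinates (v Fin.zero))) (rowString-length (v ∘ Fin.suc)))

-- The polynomial time bound

run-halted : ∀ {s} t (σ : Store s) → run t ([] , σ) ≡ ([] , σ)
run-halted zero    σ = refl
run-halted (suc t) σ = run-halted t σ

computes : ∀ {s} {M : Program (suc s)} {t x y σ} →
           M ⊢ x ∷ Vec.replicate s [] ⇒ y ∷ σ within t → Computes M t x y
computes {s} {M} {t} {x} {y} {σ} (runs u u≤t r) = σ , (begin
  run t (M , x ∷ Vec.replicate s [])                    ≡⟨ cong (λ t → run t (M , x ∷ Vec.replicate s [])) (m+[n∸m]≡n u≤t) ⟨
  run (u + (t ∸ u)) (M , x ∷ Vec.replicate s [])        ≡⟨ run-+ u (t ∸ u) _ ⟩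
  run (t ∸ u) (run u (M , x ∷ Vec.replicate s []))      ≡⟨ cong (λ M → run (t ∸ u) (run u (M , x ∷ Vec.replicate s []))) (List.++-identityʳ M) ⟨
  run (t ∸ u) (run u (M ++ [] , x ∷ Vec.replicate s [])) ≡⟨ cong (run (t ∸ u)) (r []) ⟩
  run (t ∸ u) ([] , y ∷ σ)                              ≡⟨ run-halted (t ∸ u) (y ∷ σ) ⟩
  ([] , y ∷ σ)                                          ∎)
  where open ≡-Reasoning

computes-≡ : ∀ {s} {M : Program (suc s)} {t t′ x x′ y y′ σ} → t ≡ t′ → x ≡ x′ → y ≡ y′ →
             M ⊢ x ∷ Vec.replicate s [] ⇒ y ∷ σ within t → Computes M t′ x′ y′
computes-≡ refl refl refl = computes

scale-cube : ∀ a b x → a * (b * x) ^ 3 ≡ a * b ^ 3 * x ^ 3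
scale-cube = solve 3 (λ a b x → a :* (b :* x) :^ 3 := a :* b :^ 3 :* x :^ 3) refl
  where open +-*-Solver

abstract
  -- The factor `4 ^ 3` arises from expressing `Y` as four times n + ⌈log₂ q⌉.
  coefficient : ℕ
  coefficient = 2066 * 4 ^ 3

  scale-cost : ∀ x → 2066 * (4 * x) ^ 3 ≡ coefficient * x ^ 3
  scale-cost = scale-cube 2066 4

module Computation (Φ : FiniteField) {k n : ℕ} (k≤n : k ≤ n)
  (G H : Vector (Vector (FiniteField.Carrier Φ) n) k) where

  open FiniteField Φ using (F; p; m; modulus; coordinates; q)
  open FieldStrings Φ
  open ReducedMatrix F using (reduced)

  private
    L Q X Y : ℕ
    L = ⌊log₂ p ⌋
    Q = ⌈log₂ q ⌉
    X = n + Q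
    Y = 4 * X

    open ≤-Reasoning

    1≤L : 1 ≤ L
    1≤L = ⌊log₂⌋-mono-≤ 1<p

    -- Logarithms are taken in `(2 ^ L) ^ m ≤ p ^ m`, whose right side is q.
    mL≤Q : m * L ≤ Q
    mL≤Q = begin
      m * L                  ≡⟨ ⌈log₂2^n⌉≡n (m * L) ⟨
      ⌈log₂ 2 ^ (m * L) ⌉    ≡⟨ cong (λ e → ⌈log₂ 2 ^ e ⌉) (*-comm m L) ⟩
      ⌈log₂ 2 ^ (L * m) ⌉    ≡⟨ cong ⌈log₂_⌉ (^-*-assoc 2 L m) ⟨
      ⌈log₂ (2 ^ L) ^ m ⌉    ≤⟨ ⌈log₂⌉-mono-≤ (^-monoˡ-≤ m (2^⌊log₂n⌋≤n p {{>-nonZero (<-trans 0<1+n 1<p)}})) ⟩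
      Q                      ∎

    m≤Q : m ≤ Q
    m≤Q = begin
      m        ≡⟨ *-identityʳ m ⟨
      m * 1    ≤⟨ *-monoʳ-≤ m 1≤L ⟩
      m * L    ≤⟨ mL≤Q ⟩
      Q        ∎

    1≤m : 1 ≤ m
    1≤m = >-nonZero⁻¹ m

    n≤Y : n ≤ Y
    n≤Y = ≤-trans (m≤m+n n Q) (m≤m+n X _)

    -- This fixes the factor 4 in `Y`: the parts 1, `2 * m` and `m * L` of the length are at most
    -- `Q`, `2 * Q` and `Q`.
    element≤Y : suc (m * (2 + L)) ≤ Y
    element≤Y = begin
      1 + m * (2 + L)          ≡⟨ cong suc (*-distribˡ-+ m 2 L) ⟩
      1 + (m * 2 + m * L)      ≡⟨ cong (λ e → 1 + (e + m * L)) (*-comm m 2) ⟩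
      1 + (2 * m + m * L)      ≤⟨ +-mono-≤ (≤-trans 1≤m m≤Q) (+-mono-≤ (*-monoʳ-≤ 2 m≤Q) mL≤Q) ⟩
      Q + (2 * Q + Q)          ≡⟨ cong (Q +_) (+-comm (2 * Q) Q) ⟩
      4 * Q                    ≤⟨ *-monoʳ-≤ 4 (m≤n+m Q n) ⟩
      Y                        ∎

    instance
      Y≢0 : NonZero Y
      Y≢0 = >-nonZero (≤-trans (s≤s z≤n) element≤Y)

    digits≤Y : m * (2 + L) ≤ Y
    digits≤Y = ≤-trans (n≤1+n _) element≤Y

    number≤Y : length (binary (suc L) p) ≤ Y
    number≤Y = begin
      length (binary (suc L) p)    ≡⟨ binary-length (suc L) p ⟩
      suc L                        ≤⟨ n≤1+n _ ⟩
      2 + L                        ≡⟨ *-identityˡ (2 + L) ⟨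
      1 * (2 + L)                  ≤⟨ *-monoˡ-≤ (2 + L) 1≤m ⟩
      m * (2 + L)                  ≤⟨ digits≤Y ⟩
      Y                            ∎

    ε≤Y : suc (length ε) ≤ Y
    ε≤Y = ≤-trans (≤-reflexive (trans (cong length (sym string-0)) (element-length (coordinates 𝔽.0#)))) element≤Y

    rows-valid : ∀ (A : Vector (Vector (FiniteField.Carrier Φ) n) k) →
                 All (λ r → length r ≤ Y ^ 2 × All RowSymbol r) (rows A)
    rows-valid A = All.tabulate⁺ λ i →
      (begin
        length (rowString (A i))      ≡⟨ rowString-length (A i) ⟩
        n * suc (m * (2 + L))         ≤⟨ *-mono-≤ n≤Y element≤Y ⟩
        Y * Y                         ≡⟨ cong (Y *_) (*-identityʳ Y) ⟨
        Y ^ 2                         ∎)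
      , rowString-RowSymbol (A i)

    rows≤Y : ∀ (A : Vector (Vector (FiniteField.Carrier Φ) n) k) → length (rows A) ≤ Y
    rows≤Y A = ≤-trans (≤-reflexive (List.length-tabulate (rowString ∘ A))) (≤-trans k≤n n≤Y)

  reduction-computes : Computes reduction (coefficient * (n + ⌈log₂ q ⌉) ^ 3)
    (number p ++ element modulus ++ unary k ++ unary n ++ matrixString′ G ++ matrixString′ H)
    (number p ++ element modulus ++ unary (suc k) ++ unary (reducedLength n) ++
      matrixString′ (reduced G) ++ matrixString′ (reduced H))
  reduction-computes = computes-≡ (scale-cost X) input≡ output≡
    (Cost.within (Reduction.reduction-costs Y ε ε≤Y n n≤Y
      number≤Y (binary-All (λ _ → refl) (suc L) p)
      (≤-trans (≤-reflexive (digits-length modulus)) digits≤Y) (digits-All (λ _ → refl) refl modulus) zeroed-modulus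
      (≤-trans k≤n n≤Y) (rows≤Y G) (rows-valid G) (rows≤Y H) (rows-valid H)))
    where
    input≡ = cong₂ (λ g h → number p ++ element modulus ++ unary k ++ unary n ++ g ++ h)
      (sym (matrixString-rows G)) (sym (matrixString-rows H))
    output≡ = trans
      (cong₂ (λ g h → number p ++ element modulus ++ unary (suc k) ++ unary (suc (n * 6)) ++ g ++ h)
        (sym (matrixString-reduced G)) (sym (matrixString-reduced H)))
      (cong (λ n′ → number p ++ element modulus ++ unary (suc k) ++ unary n′ ++ matrixString′ (reduced G) ++ matrixString′ (reduced H))
        (sym (reducedLength≡ n)))

-- The image of an instance

module Image (I : Instance) where

  open Instance I
  open FieldStrings finiteField using (1<p; m≢0)
  open FiniteVectors finiteField
  open ReducedMatrix F using (reduced)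

  private
    p m : ℕ
    p = FiniteField.p finiteField
    m = FiniteField.m finiteField

    G-independent : LinearlyIndependent G
    G-independent = generator⇒independent G-generator

    1<q : 1 < q
    1<q = <-≤-trans 1<p (≤-trans (≤-reflexive (sym (^-identityʳ p)))
      (^-monoʳ-≤ p {{>-nonZero (<-trans 0<1+n 1<p)}} (>-nonZero⁻¹ m {{m≢0}})))

  -- The time bound involves n and log q only, so the number of rows has to be controlled by n.
  rank≤length : k ≤ n
  rank≤length = injective⇒dimension≤ (independent⇒injective {A = G} G-independent) 1<q

  image : Instance
  image = record
    { finiteField = finiteField
    ; k           = suc k
    ; n           = reducedLength n
    ; G           = reduced G
    ; H           = reduced H
    ; G-generator = independent⇒generator {A = reduced G} (reduced-independent {A = G} G-independent)
    ; H-generator = independent⇒generator {A = reduced H} (reduced-independent {A = H} (generator⇒independent H-generator))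
    }

  PCE⇔LCE : PCE I ⇔ LCE image
  PCE⇔LCE = mk⇔ reduction-complete (reduction-sound G-independent)

theorem3p1 : ∃[ s ] Σ[ M ∈ Program (suc s) ] Σ[ c ∈ ℕ ] Σ[ d ∈ ℕ ]
    ((I : Instance) → Σ[ I′ ∈ Instance ]
    (Computes M (c * (Instance.n I + ⌈log₂ Instance.q I ⌉) ^ d) (encode I) (encode I′)
    × (PCE I ⇔ LCE I′)))
theorem3p1 = 6 , reduction , coefficient , 3 , λ I → let open Image I in
  image , Computation.reduction-computes (Instance.finiteField I) rank≤length (Instance.G I) (Instance.H I) , PCE⇔LCE
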